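{- Let $G=\{g_1,\ldots,g_n\}$ be a finite abelian group of order $n$, with irreducible complex characters $\chi_1,\ldots,\chi_n$ ordered so that $\{\chi_1,\ldots,\chi_k\}$ is a maximal subset of irreducible characters which are pairwise not algebraically conjugate, and let $q_i$ be the order of $\chi_i$. Let $\phi:\mathbb{Q}G\to\mathbb{Q}(\zeta_{q_1})\oplus\cdots\oplus\mathbb{Q}(\zeta_{q_k})$ be the map $h\mapsto(\chi_1(h),\ldots,\chi_k(h))$. Then the restriction of $\phi$ to $\mathbb{Z}G$ gives a $\mathbb{Z}$-algebra homomorphism $$\psi:\mathbb{Z}G\hookrightarrow\mathbb{Z}[\zeta_{q_1}]\oplus\cdots\oplus\mathbb{Z}[\zeta_{q_k}],$$ which is injective. If $h=\sum_{i=1}^n h_ig_i\in\mathbb{Z}G$, then $\psi(h)=(c_1,\ldots,c_k)$, where $$\begin{pmatrix}c_1\\ \vdots\\ c_k\end{pmatrix}=B\begin{pmatrix}h_1\\ \vdots\\ h_n\end{pmatrix}.$$ If $(c_1,\ldots,c_k)\in\psi(\mathbb{Z}G)$, then $\psi^{ -1}((c_1,\ldots,c_k))=\sum_{i=1}^n h_ig_i$, where, setting $c_i=\sigma_i(c_{k_i})$ for $k<i\le n$, $$\begin{pmatrix}h_1\\ \vdots\\ h_n\end{pmatrix}=A^{ -1}\begin{pmatrix}c_1\\ \vdots\\ c_n\end{pmatrix}.$$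
   Context: Characters of $G$ are homomorphisms $G\to\mathbb{C}^{*}$, extended linearly to the group ring; there are exactly $n$ irreducible ones. For a positive integer $q$, $\zeta_q$ denotes a primitive $q$-th root of unity in $\mathbb{C}$. The order $q_i$ of $\chi_i$ is its order in the character group $\widehat{G}$, so $\chi_i$ takes values in $\mathbb{Q}(\zeta_{q_i})$ on $\mathbb{Q}G$. Two characters $\chi_i,\chi_j$ with values in some Galois number field $K$ are algebraically conjugate if there is an automorphism $\sigma$ of $K$ with $\chi_j=\sigma(\chi_i)$ (that is, $\chi_j(g)=\sigma(\chi_i(g))$ for all $g\in G$). For each $i$ with $k<i\le n$, $k_i$ denotes the unique index with $1\le k_i\le k$ such that $\chi_i$ and $\chi_{k_i}$ are algebraically conjugate, and $\sigma_i$ is the automorphism of $\mathbb{Q}(\zeta_{q_{k_i}})$ such that $\sigma_i(\chi_{k_i})=\chi_i$. $A=(\chi_i(g_j))_{i,j=1,\ldots,n}$ is the character matrix of $G$ (it is invertible), and $B$ is the $k\times n$ matrix made of the first $k$ rows of $A$. -}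

module Defs where

open import Algebra.Bundles using (AbelianGroup; CommutativeRing)
open import Algebra.Bundles.Raw using (RawGroup; RawMonoid; RawRing)
import Algebra.Definitions.RawMonoid as RawMonoidOperations
open import Algebra.Morphism.Structures using (IsGroupHomomorphism; IsRingIsomorphism)
open import Data.Bool.Base using (if_then_else_)
open import Data.Fin.Base using (Fin)
import Data.Fin.Properties as Fin
open import Data.Integer.Base using (ℤ)
open import Data.Nat.Base as ℕ using (ℕ)
import Data.Nat.Properties as ℕ
open import Data.Product.Base using (Σ; Σ-syntax; ∃; ∃-syntax; _×_; _,_; proj₁; proj₂)
open import Data.Rational.Base as ℚ using (ℚ; 0ℚ; 1ℚ)
import Data.Rational.Properties as ℚ
open import Data.Vec.Functional using (Vector)
open import Function.Bundles using (Inverse)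
open import Level using (Level; 0ℓ; _⊔_) renaming (suc to lsuc)
open import Relation.Binary.Bundles using (Setoid)
open import Relation.Binary.PropositionalEquality as ≡ using (_≡_; _≢_; refl; cong; sym; trans; subst)
open import Relation.Nullary using (¬_; does)
open import Relation.Nullary.Decidable.Core using (dec⇒maybe)
open import Relation.Unary using (Pred; _⊆_)
open import Tactic.RingSolver.Core.AlmostCommutativeRing using (fromCommutativeRing)
import Tactic.RingSolver.NonReflective as RingSolver

private
  variable
    a b ℓ ℓ′ : Level

module Cauchy where
  open import Data.Rational.Base
  open import Data.Rational.Properties

  -- |xₘ − yₙ| → 0 as m, n → ∞.  So x is a Cauchy sequence iff x ∼ x, and Cauchy
  -- sequences x and y have the same limit iff x ∼ y.
  infix 4 _∼_
  _∼_ : (ℕ → ℚ) → (ℕ → ℚ) → Set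
  x ∼ y = ∀ ε → 0ℚ < ε → ∃ λ N → ∀ m n → N ℕ.≤ m → N ℕ.≤ n → ∣ x m - y n ∣ < ε

  private
    module ℚ-Solver = RingSolver (fromCommutativeRing +-*-commutativeRing (λ x → dec⇒maybe (0ℚ ≟ x)))
    open ℚ-Solver using (solve; _⊜_; _⊕_; _⊗_; ⊝_)

    halve : ∀ ε → ½ * ε + ½ * ε ≡ ε
    halve ε = trans (sym (*-distribʳ-+ ε ½ ½)) (*-identityˡ ε)

    half-pos : ∀ {ε} → 0ℚ < ε → 0ℚ < ½ * ε
    half-pos {ε} ε>0 = subst (_< ½ * ε) (*-zeroʳ ½) (*-monoʳ-<-pos ½ ε>0)

    divide : ∀ b ε → 0ℚ < b → 0ℚ < ε → ∃ λ δ → 0ℚ < δ × b * δ ≡ ε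
    divide b ε b>0 ε>0 = (1/ b) * ε , δ>0 ,
        trans (sym (*-assoc b (1/ b) ε)) (trans (cong (_* ε) (*-inverseʳ b)) (*-identityˡ ε))
      where
      instance
        b-pos : Positive b
        b-pos = positive b>0
        b-nonZero : NonZero b
        b-nonZero = pos⇒nonZero b
        1/b-pos : Positive (1/ b)
        1/b-pos = 1/pos⇒pos b
      δ>0 : 0ℚ < (1/ b) * ε
      δ>0 = subst (_< (1/ b) * ε) (*-zeroʳ (1/ b)) (*-monoʳ-<-pos (1/ b) ε>0)

    triangle : ∀ {d a b ε} → d ≡ a + b → ∣ a ∣ < ½ * ε → ∣ b ∣ < ½ * ε → ∣ d ∣ < ε
    triangle {d} {a} {b} {ε} refl a< b< = subst (∣ a + b ∣ <_) (halve ε)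
      (≤-<-trans (∣p+q∣≤∣p∣+∣q∣ a b) (+-mono-< a< b<))

    swap : ∀ a b → ∣ a - b ∣ ≡ ∣ b - a ∣
    swap a b = trans (cong ∣_∣ (solve 2 (λ a b → (a ⊕ (⊝ b)) ⊜ (⊝ (b ⊕ (⊝ a)))) refl a b)) (∣-p∣≡∣p∣ (b - a))

  ∼-sym : ∀ {x y} → x ∼ y → y ∼ x
  ∼-sym {x} {y} p ε ε>0 with p ε ε>0
  ... | N , h = N , λ m n m≥ n≥ → subst (_< ε) (swap (x n) (y m)) (h n m n≥ m≥)

  private
    combine : ∀ {x x′ y y′} {z z′ : ℕ → ℚ} →
              (∀ ε → 0ℚ < ε → ∃ λ δ → 0ℚ < δ × ∃ λ K →
                ∀ m n → K ℕ.≤ m → K ℕ.≤ n →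
                ∣ x m - x′ n ∣ < δ → ∣ y m - y′ n ∣ < δ → ∣ z m - z′ n ∣ < ε) →
              x ∼ x′ → y ∼ y′ → z ∼ z′
    combine h p q ε ε>0 =
      let δ , δ>0 , K , f = h ε ε>0
          M , P = p δ δ>0
          N , Q = q δ δ>0
      in K ℕ.⊔ (M ℕ.⊔ N) , λ m n m≥ n≥ →
         f m n (ℕ.m⊔n≤o⇒m≤o K _ m≥) (ℕ.m⊔n≤o⇒m≤o K _ n≥)
           (P m n (ℕ.m⊔n≤o⇒m≤o M N (ℕ.m⊔n≤o⇒n≤o K _ m≥)) (ℕ.m⊔n≤o⇒m≤o M N (ℕ.m⊔n≤o⇒n≤o K _ n≥)))
           (Q m n (ℕ.m⊔n≤o⇒n≤o M N (ℕ.m⊔n≤o⇒n≤o K _ m≥)) (ℕ.m⊔n≤o⇒n≤o M N (ℕ.m⊔n≤o⇒n≤o K _ n≥)))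

  ∼-trans : ∀ {x y z} → x ∼ y → y ∼ z → x ∼ z
  ∼-trans {x} {y} {z} p q ε ε>0 =
    let M , P = p (½ * ε) (half-pos ε>0)
        N , Q = q (½ * ε) (half-pos ε>0)
        K = M ℕ.⊔ N
    in K , λ m n m≥ n≥ →
       triangle {a = x m - y K} {b = y K - z n} (solve 3 (λ a b c → (a ⊕ (⊝ c)) ⊜ ((a ⊕ (⊝ b)) ⊕ (b ⊕ (⊝ c)))) refl (x m) (y K) (z n))
         (P m K (ℕ.m⊔n≤o⇒m≤o M N m≥) (ℕ.m≤m⊔n M N))
         (Q K n (ℕ.m≤n⊔m M N) (ℕ.m⊔n≤o⇒n≤o M N n≥))

  +-∼ : ∀ {x x′ y y′} → x ∼ x′ → y ∼ y′ → (λ n → x n + y n) ∼ (λ n → x′ n + y′ n)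
  +-∼ {x} {x′} {y} {y′} = combine {x} {x′} {y} {y′} {λ n → x n + y n} {λ n → x′ n + y′ n} λ ε ε>0 →
    ½ * ε , half-pos ε>0 , 0 , λ m n _ _ →
    triangle {a = x m - x′ n} {b = y m - y′ n} (solve 4 (λ a b c d → ((a ⊕ b) ⊕ (⊝ (c ⊕ d))) ⊜ ((a ⊕ (⊝ c)) ⊕ (b ⊕ (⊝ d)))) refl (x m) (y m) (x′ n) (y′ n))

  neg-∼ : ∀ {x x′} → x ∼ x′ → (λ n → - x n) ∼ (λ n → - x′ n)
  neg-∼ {x} {x′} p ε ε>0 with p ε ε>0
  ... | N , h = N , λ m n m≥ n≥ → subst (_< ε)
    (trans (swap (x m) (x′ n))
      (cong ∣_∣ (solve 2 (λ a b → (b ⊕ (⊝ a)) ⊜ ((⊝ a) ⊕ (⊝ (⊝ b)))) refl (x m) (x′ n))))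
    (h m n m≥ n≥)

  private
    bound : ∀ {a b} → ∣ a - b ∣ < 1ℚ → ∣ a ∣ < 1ℚ + ∣ b ∣
    bound {a} {b} a-b< = subst (λ c → ∣ c ∣ < 1ℚ + ∣ b ∣)
      (solve 2 (λ a b → ((a ⊕ (⊝ b)) ⊕ b) ⊜ a) refl a b)
      (≤-<-trans (∣p+q∣≤∣p∣+∣q∣ (a - b) b) (+-monoˡ-< ∣ b ∣ a-b<))

    0<1+ : ∀ b → 0ℚ < 1ℚ + ∣ b ∣
    0<1+ b = +-mono-<-≤ (positive⁻¹ 1ℚ) (0≤∣p∣ b)

    product-bound : ∀ {a b C δ ε} → 0ℚ < C → 0ℚ < δ → ∣ a ∣ < C → ∣ b ∣ < δ → C * δ ≡ ε → ∣ a * b ∣ < ε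
    product-bound {a} {b} {C} {δ} C>0 δ>0 a< b< refl =
      subst (_< C * δ) (sym (∣p*q∣≡∣p∣*∣q∣ a b))
        (≤-<-trans (*-monoʳ-≤-nonNeg ∣ b ∣ {{nonNegative (0≤∣p∣ b)}} (<⇒≤ a<))
                   (*-monoʳ-<-pos C {{positive C>0}} b<))

  *-∼ : ∀ {x x′ y y′} → x ∼ x′ → y ∼ y′ → (λ n → x n * y n) ∼ (λ n → x′ n * y′ n)
  *-∼ {x} {x′} {y} {y′} p q =
    combine {x} {x′} {y} {y′} {λ n → x n * y n} {λ n → x′ n * y′ n} step p q
    where
    0<1 = positive⁻¹ 1ℚ
    M = proj₁ (p 1ℚ 0<1)
    P = proj₂ (p 1ℚ 0<1)
    N = proj₁ (q 1ℚ 0<1)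
    Q = proj₂ (q 1ℚ 0<1)
    C = (1ℚ + ∣ x′ M ∣) + (1ℚ + ∣ y N ∣)
    C>0 : 0ℚ < C
    C>0 = +-mono-< (0<1+ (x′ M)) (0<1+ (y N))
    x<C : ∀ {m} → M ℕ.≤ m → ∣ x m ∣ < C
    x<C m≥ = <-trans (bound {b = x′ M} (P _ M m≥ ℕ.≤-refl)) (subst (_< C) (+-identityʳ (1ℚ + ∣ x′ M ∣)) (+-monoʳ-< (1ℚ + ∣ x′ M ∣) (0<1+ (y N))))
    y′<C : ∀ {n} → N ℕ.≤ n → ∣ y′ n ∣ < C
    y′<C n≥ = <-trans (bound {b = y N} (subst (_< 1ℚ) (swap (y N) (y′ _)) (Q N _ ℕ.≤-refl n≥)))
                (subst (_< C) (+-identityˡ (1ℚ + ∣ y N ∣)) (+-monoˡ-< (1ℚ + ∣ y N ∣) (0<1+ (x′ M))))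
    step : ∀ ε → 0ℚ < ε → ∃ λ δ → 0ℚ < δ × ∃ λ K → ∀ m n → K ℕ.≤ m → K ℕ.≤ n →
           ∣ x m - x′ n ∣ < δ → ∣ y m - y′ n ∣ < δ → ∣ x m * y m - x′ n * y′ n ∣ < ε
    step ε ε>0 =
      let δ , δ>0 , Cδ≡ = divide C (½ * ε) C>0 (half-pos ε>0)
      in δ , δ>0 , M ℕ.⊔ N , λ m n m≥ n≥ dx dy →
         triangle {a = x m * (y m - y′ n)} {b = y′ n * (x m - x′ n)}
           (solve 4 (λ a b c d → ((a ⊗ b) ⊕ (⊝ (c ⊗ d))) ⊜ ((a ⊗ (b ⊕ (⊝ d))) ⊕ (d ⊗ (a ⊕ (⊝ c))))) refl
              (x m) (y m) (x′ n) (y′ n))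
           (product-bound C>0 δ>0 (x<C (ℕ.m⊔n≤o⇒m≤o M N m≥)) dy Cδ≡)
           (product-bound C>0 δ>0 (y′<C (ℕ.m⊔n≤o⇒n≤o M N n≥)) dx Cδ≡)

-- Real numbers are Cauchy sequences of rationals, not quotiented: _≃_ is their
-- equality.
record ℝ : Set where
  constructor real
  field
    seq    : ℕ → ℚ
    cauchy : seq Cauchy.∼ seq

open ℝ

infix 4 _≃_
record _≃_ (x y : ℝ) : Set where
  constructor same-limit
  field
    limits : seq x Cauchy.∼ seq y

open _≃_

fromℚᴿ : ℚ → ℝ
fromℚᴿ r = real (λ _ → r) λ ε ε>0 → 0 , λ _ _ _ _ → subst (ℚ._< ε) (sym (cong ℚ.∣_∣ (ℚ.+-inverseʳ r))) ε>0

ℝ-commutativeRing : CommutativeRing 0ℓ 0ℓ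
ℝ-commutativeRing = record
  { Carrier = ℝ
  ; _≈_ = _≃_
  ; _+_ = λ x y → real (λ n → seq x n ℚ.+ seq y n) (Cauchy.+-∼ {seq x} {seq x} {seq y} {seq y} (cauchy x) (cauchy y))
  ; _*_ = λ x y → real (λ n → seq x n ℚ.* seq y n) (Cauchy.*-∼ {seq x} {seq x} {seq y} {seq y} (cauchy x) (cauchy y))
  ; -_ = λ x → real (λ n → ℚ.- seq x n) (Cauchy.neg-∼ {seq x} {seq x} (cauchy x))
  ; 0# = fromℚᴿ 0ℚ
  ; 1# = fromℚᴿ 1ℚ
  ; isCommutativeRing = record
    { isRing = record
      { +-isAbelianGroup = record
        { isGroup = record
          { isMonoid = record
            { isSemigroup = record
              { isMagma = record
                { isEquivalence = record
                  { refl  = λ {x} → same-limit (cauchy x)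
                  ; sym   = λ {x} {y} p → same-limit (Cauchy.∼-sym {seq x} {seq y} (limits p))
                  ; trans = λ {x} {y} {z} p q → same-limit (Cauchy.∼-trans {seq x} {seq y} {seq z} (limits p) (limits q))
                  }
                ; ∙-cong = λ {x} {x′} {y} {y′} p q →
                    same-limit (Cauchy.+-∼ {seq x} {seq x′} {seq y} {seq y′} (limits p) (limits q))
                }
              ; assoc = λ x y z → pointwise λ n → ℚ.+-assoc (seq x n) (seq y n) (seq z n)
              }
            ; identity = (λ x → pointwise λ n → ℚ.+-identityˡ (seq x n))
                       , (λ x → pointwise λ n → ℚ.+-identityʳ (seq x n))
            }
          ; inverse = (λ x → pointwise λ n → ℚ.+-inverseˡ (seq x n))
                    , (λ x → pointwise λ n → ℚ.+-inverseʳ (seq x n))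
          ; ⁻¹-cong = λ {x} {x′} p → same-limit (Cauchy.neg-∼ {seq x} {seq x′} (limits p))
          }
        ; comm = λ x y → pointwise λ n → ℚ.+-comm (seq x n) (seq y n)
        }
      ; *-cong = λ {x} {x′} {y} {y′} p q →
          same-limit (Cauchy.*-∼ {seq x} {seq x′} {seq y} {seq y′} (limits p) (limits q))
      ; *-assoc = λ x y z → pointwise λ n → ℚ.*-assoc (seq x n) (seq y n) (seq z n)
      ; *-identity = (λ x → pointwise λ n → ℚ.*-identityˡ (seq x n))
                   , (λ x → pointwise λ n → ℚ.*-identityʳ (seq x n))
      ; distrib = (λ x y z → pointwise λ n → ℚ.*-distribˡ-+ (seq x n) (seq y n) (seq z n))
                , (λ x y z → pointwise λ n → ℚ.*-distribʳ-+ (seq x n) (seq y n) (seq z n))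
      }
    ; *-comm = λ x y → pointwise λ n → ℚ.*-comm (seq x n) (seq y n)
    }
  }
  where
  pointwise : ∀ {x y} → (∀ n → seq x n ≡ seq y n) → x ≃ y
  pointwise {x} {y} x≡y = same-limit λ ε ε>0 →
    let N , h = cauchy x ε ε>0
    in N , λ m n m≥ n≥ → subst (λ t → ℚ.∣ seq x m ℚ.- t ∣ ℚ.< ε) (x≡y n) (h m n m≥ n≥)

-- The ring R[i]: complex numbers, with R in place of the real numbers.
module AdjoinI (base : CommutativeRing 0ℓ 0ℓ) where
  private
    module R = CommutativeRing base
  open R using (Carrier; _≈_; _+_; _*_; -_; 0#; 1#)

  record R[i] : Set where
    constructor _+i_
    field
      re im : Carrier

  open R[i] public

  infix 4 _≈ᶜ_
  record _≈ᶜ_ (z w : R[i]) : Set where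
    constructor _,_
    field
      re≈ : re z ≈ re w
      im≈ : im z ≈ im w

  R[i]-commutativeRing : CommutativeRing 0ℓ 0ℓ
  R[i]-commutativeRing = record
    { Carrier = R[i]
    ; _≈_ = _≈ᶜ_
    ; _+_ = λ z w → (re z + re w) +i (im z + im w)
    ; _*_ = λ z w → (re z * re w + - (im z * im w)) +i (re z * im w + im z * re w)
    ; -_ = λ z → (- re z) +i (- im z)
    ; 0# = 0# +i 0#
    ; 1# = 1# +i 0#
    ; isCommutativeRing = record
      { isRing = record
        { +-isAbelianGroup = record
          { isGroup = record
            { isMonoid = record
              { isSemigroup = record
                { isMagma = record
                  { isEquivalence = record
                    { refl  = R.refl , R.refl
                    ; sym   = λ (p , q) → R.sym p , R.sym q
                    ; trans = λ (p , q) (p′ , q′) → R.trans p p′ , R.trans q q′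
                    }
                  ; ∙-cong = λ (p , q) (p′ , q′) → R.+-cong p p′ , R.+-cong q q′
                  }
                ; assoc = λ z w v → R.+-assoc (re z) (re w) (re v) , R.+-assoc (im z) (im w) (im v)
                }
              ; identity = (λ z → R.+-identityˡ (re z) , R.+-identityˡ (im z))
                         , (λ z → R.+-identityʳ (re z) , R.+-identityʳ (im z))
              }
            ; inverse = (λ z → R.-‿inverseˡ (re z) , R.-‿inverseˡ (im z))
                      , (λ z → R.-‿inverseʳ (re z) , R.-‿inverseʳ (im z))
            ; ⁻¹-cong = λ (p , q) → R.-‿cong p , R.-‿cong q
            }
          ; comm = λ z w → R.+-comm (re z) (re w) , R.+-comm (im z) (im w)
          }
        ; *-cong = *-cong
        ; *-assoc = *-assoc
        ; *-identity = *-identityˡ , λ z → ≈-trans (*-comm z (1# +i 0#)) (*-identityˡ z)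
        ; distrib = distribˡ , λ z w v →
            ≈-trans (*-comm (w ⊹ v) z) (≈-trans (distribˡ z w v) (⊹-cong (*-comm z w) (*-comm z v)))
        }
      ; *-comm = *-comm
      }
    }
    where
    open import Algebra.Properties.Ring R.ring using (-1*x≈-x; -0#≈0#)
    open import Algebra.Solver.Ring.NaturalCoefficients.Default R.commutativeSemiring
    ≈-sym : ∀ {z w} → z ≈ᶜ w → w ≈ᶜ z
    ≈-sym (p , q) = R.sym p , R.sym q
    _⊹_ _∙_ : R[i] → R[i] → R[i]
    z ⊹ w = (re z + re w) +i (im z + im w)
    z ∙ w = (re z * re w + - (im z * im w)) +i (re z * im w + im z * re w)
    ≈-trans : ∀ {z w v} → z ≈ᶜ w → w ≈ᶜ v → z ≈ᶜ v
    ≈-trans (p , q) (p′ , q′) = R.trans p p′ , R.trans q q′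
    ⊹-cong : ∀ {z z′ w w′} → z ≈ᶜ z′ → w ≈ᶜ w′ → z ⊹ w ≈ᶜ z′ ⊹ w′
    ⊹-cong (p , q) (p′ , q′) = R.+-cong p p′ , R.+-cong q q′
    *-cong : ∀ {z z′ w w′} → z ≈ᶜ z′ → w ≈ᶜ w′ → z ∙ w ≈ᶜ z′ ∙ w′
    *-cong (p , q) (p′ , q′) =
      R.+-cong (R.*-cong p p′) (R.-‿cong (R.*-cong q q′)) , R.+-cong (R.*-cong p q′) (R.*-cong q p′)
    -- Multiplication with −1 as a parameter, so that the ring laws hold already
    -- over commutative semirings.
    mul : R.Carrier → R[i] → R[i] → R[i]
    mul t z w = (re z * re w + t * (im z * im w)) +i (re z * im w + im z * re w)
    ∙≈mul : ∀ z w → z ∙ w ≈ᶜ mul (- 1#) z w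
    ∙≈mul z w = R.+-congˡ (R.sym (-1*x≈-x _)) , R.refl
    mul-cong : ∀ {z z′ w w′} → z ≈ᶜ z′ → w ≈ᶜ w′ → mul (- 1#) z w ≈ᶜ mul (- 1#) z′ w′
    mul-cong (p , q) (p′ , q′) =
      R.+-cong (R.*-cong p p′) (R.*-congˡ (R.*-cong q q′)) , R.+-cong (R.*-cong p q′) (R.*-cong q p′)
    *-comm : ∀ z w → z ∙ w ≈ᶜ w ∙ z
    *-comm (a +i b) (c +i d) =
      R.+-cong (R.*-comm a c) (R.-‿cong (R.*-comm b d)) ,
      R.trans (R.+-comm _ _) (R.+-cong (R.*-comm b c) (R.*-comm a d))
    *-identityˡ : ∀ z → (1# +i 0#) ∙ z ≈ᶜ z
    *-identityˡ (a +i b) =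
      R.trans (R.+-cong (R.*-identityˡ a) (R.trans (R.-‿cong (R.zeroˡ b)) -0#≈0#)) (R.+-identityʳ a) ,
      R.trans (R.+-cong (R.*-identityˡ b) (R.zeroˡ a)) (R.+-identityʳ b)
    *-assoc : ∀ z w v → (z ∙ w) ∙ v ≈ᶜ z ∙ (w ∙ v)
    *-assoc z w v =
      ≈-trans (∙≈mul (z ∙ w) v) (≈-trans (mul-cong (∙≈mul z w) (R.refl , R.refl))
        (≈-trans (law z w v) (≈-sym (≈-trans (∙≈mul z (w ∙ v)) (mul-cong (R.refl , R.refl) (∙≈mul w v))))))
      where
      law : ∀ z w v → mul (- 1#) (mul (- 1#) z w) v ≈ᶜ mul (- 1#) z (mul (- 1#) w v)
      law (a +i b) (c +i d) (e +i f) =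
        solve 7 (λ t a b c d e f →
          (a :* c :+ t :* (b :* d)) :* e :+ t :* ((a :* d :+ b :* c) :* f)
          := a :* (c :* e :+ t :* (d :* f)) :+ t :* (b :* (c :* f :+ d :* e))) R.refl (- 1#) a b c d e f ,
        solve 7 (λ t a b c d e f →
          (a :* c :+ t :* (b :* d)) :* f :+ (a :* d :+ b :* c) :* e
          := a :* (c :* f :+ d :* e) :+ b :* (c :* e :+ t :* (d :* f))) R.refl (- 1#) a b c d e f
    distribˡ : ∀ z w v → z ∙ (w ⊹ v) ≈ᶜ (z ∙ w) ⊹ (z ∙ v)
    distribˡ z w v =
      ≈-trans (∙≈mul z (w ⊹ v)) (≈-trans (law z w v) (≈-sym (⊹-cong (∙≈mul z w) (∙≈mul z v))))
      where
      law : ∀ z w v → mul (- 1#) z (w ⊹ v) ≈ᶜ mul (- 1#) z w ⊹ mul (- 1#) z v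
      law (a +i b) (c +i d) (e +i f) =
        solve 7 (λ t a b c d e f →
          a :* (c :+ e) :+ t :* (b :* (d :+ f))
          := (a :* c :+ t :* (b :* d)) :+ (a :* e :+ t :* (b :* f))) R.refl (- 1#) a b c d e f ,
        solve 7 (λ t a b c d e f →
          a :* (d :+ f) :+ b :* (c :+ e)
          := (a :* d :+ b :* c) :+ (a :* f :+ b :* e)) R.refl (- 1#) a b c d e f

-- ℂ = ℝ[i].  Opacity only keeps the type checker from unfolding complex arithmetic
-- into Cauchy sequences; everything below needs just the ring and the embedding of ℚ.
opaque
  ℂ-commutativeRing : CommutativeRing 0ℓ 0ℓ
  ℂ-commutativeRing = AdjoinI.R[i]-commutativeRing ℝ-commutativeRing

open CommutativeRing ℂ-commutativeRing public
  using (_≈_; _+_; _*_; -_; 0#; 1#) renaming (Carrier to ℂ)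

private
  module C = CommutativeRing ℂ-commutativeRing

opaque
  unfolding ℂ-commutativeRing

  fromℚ : ℚ → ℂ
  fromℚ r = AdjoinI._+i_ (fromℚᴿ r) (fromℚᴿ 0ℚ)

ℤ⊂ℚ : ℤ → ℚ
ℤ⊂ℚ z = z ℚ./ 1

fromℤ : ℤ → ℂ
fromℤ z = fromℚ (ℤ⊂ℚ z)

∑ : ∀ {n} → Vector ℂ n → ℂ
∑ = RawMonoidOperations.sum C.+-rawMonoid

Matrix : ℕ → ℕ → Set
Matrix m n = Fin m → Fin n → ℂ

infixr 7 _*ᵥ_
_*ᵥ_ : ∀ {m n} → Matrix m n → Vector ℂ n → Vector ℂ m
(M *ᵥ v) i = ∑ λ j → M i j * v j

_*ₘ_ : ∀ {l m n} → Matrix l m → Matrix m n → Matrix l n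
(M *ₘ N) i j = ∑ λ t → M i t * N t j

𝟙 : ∀ {n} → Matrix n n
𝟙 i j = if does (i Fin.≟ j) then 1# else 0#

IsInverse : ∀ {n} → Matrix n n → Matrix n n → Set
IsInverse M N = (∀ i j → (M *ₘ N) i j ≈ 𝟙 i j) × (∀ i j → (N *ₘ M) i j ≈ 𝟙 i j)

-- pow m x is the m-th power of x; the library's _×_ assumes additive notation.
HasOrder : (M : RawMonoid a ℓ) → RawMonoid.Carrier M → ℕ → Set ℓ
HasOrder M x q = 0 ℕ.< q × pow q x M.≈ M.ε × (∀ m → 0 ℕ.< m → m ℕ.< q → ¬ (pow m x M.≈ M.ε))
  where
  module M = RawMonoid M
  pow = RawMonoidOperations._×_ M

IsPrimitiveRoot : ℕ → ℂ → Set
IsPrimitiveRoot q ζ = HasOrder C.*-rawMonoid ζ q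

record Subring : Set₁ where
  field
    Member   : Pred ℂ 0ℓ
    resp     : ∀ {x y} → x ≈ y → Member x → Member y
    0-closed : Member 0#
    1-closed : Member 1#
    +-closed : ∀ {x y} → Member x → Member y → Member (x + y)
    *-closed : ∀ {x y} → Member x → Member y → Member (x * y)
    neg-closed : ∀ {x} → Member x → Member (- x)

  rawRing : RawRing 0ℓ 0ℓ
  rawRing = record
    { Carrier = Σ ℂ Member
    ; _≈_ = λ (x , _) (y , _) → x ≈ y
    ; _+_ = λ (x , x∈) (y , y∈) → x + y , +-closed x∈ y∈
    ; _*_ = λ (x , x∈) (y , y∈) → x * y , *-closed x∈ y∈
    ; -_ = λ (x , x∈) → - x , neg-closed x∈
    ; 0# = 0# , 0-closed
    ; 1# = 1# , 1-closed
    }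

  open RawRing rawRing public using (Carrier)

record Subfield : Set₁ where
  field
    subring   : Subring
    inv-closed : ∀ {x y} → Subring.Member subring x → x * y ≈ 1# → Subring.Member subring y

  open Subring subring public

-- Membership in the smallest subring of ℂ containing ζ.
data _∈ℤ[_] : ℂ → ℂ → Set where
  gen  : ∀ {ζ} → ζ ∈ℤ[ ζ ]
  zero : ∀ {ζ} → 0# ∈ℤ[ ζ ]
  one  : ∀ {ζ} → 1# ∈ℤ[ ζ ]
  add  : ∀ {ζ x y} → x ∈ℤ[ ζ ] → y ∈ℤ[ ζ ] → (x + y) ∈ℤ[ ζ ]
  mul  : ∀ {ζ x y} → x ∈ℤ[ ζ ] → y ∈ℤ[ ζ ] → (x * y) ∈ℤ[ ζ ]
  neg  : ∀ {ζ x} → x ∈ℤ[ ζ ] → (- x) ∈ℤ[ ζ ]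
  resp : ∀ {ζ x y} → x ≈ y → x ∈ℤ[ ζ ] → y ∈ℤ[ ζ ]

-- Membership in the smallest subfield of ℂ containing ζ.
data _∈ℚ⟨_⟩ : ℂ → ℂ → Set where
  gen  : ∀ {ζ} → ζ ∈ℚ⟨ ζ ⟩
  zero : ∀ {ζ} → 0# ∈ℚ⟨ ζ ⟩
  one  : ∀ {ζ} → 1# ∈ℚ⟨ ζ ⟩
  add  : ∀ {ζ x y} → x ∈ℚ⟨ ζ ⟩ → y ∈ℚ⟨ ζ ⟩ → (x + y) ∈ℚ⟨ ζ ⟩
  mul  : ∀ {ζ x y} → x ∈ℚ⟨ ζ ⟩ → y ∈ℚ⟨ ζ ⟩ → (x * y) ∈ℚ⟨ ζ ⟩
  neg  : ∀ {ζ x} → x ∈ℚ⟨ ζ ⟩ → (- x) ∈ℚ⟨ ζ ⟩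
  inv  : ∀ {ζ x y} → x ∈ℚ⟨ ζ ⟩ → x * y ≈ 1# → y ∈ℚ⟨ ζ ⟩
  resp : ∀ {ζ x y} → x ≈ y → x ∈ℚ⟨ ζ ⟩ → y ∈ℚ⟨ ζ ⟩

ℤ[_] : ℂ → Subring
ℤ[ ζ ] = record
  { Member = _∈ℤ[ ζ ] ; resp = resp ; 0-closed = zero ; 1-closed = one
  ; +-closed = add ; *-closed = mul ; neg-closed = neg }

ℚ⟨_⟩ : ℂ → Subfield
ℚ⟨ ζ ⟩ = record
  { subring = record
    { Member = _∈ℚ⟨ ζ ⟩ ; resp = resp ; 0-closed = zero ; 1-closed = one
    ; +-closed = add ; *-closed = mul ; neg-closed = neg }
  ; inv-closed = inv }

ℤ[ζ]⊂ℚ⟨ζ⟩ : ∀ {ζ} → Subring.Carrier ℤ[ ζ ] → Subfield.Carrier ℚ⟨ ζ ⟩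
ℤ[ζ]⊂ℚ⟨ζ⟩ {ζ} (x , x∈) = x , include x∈
  where
  include : ∀ {x} → x ∈ℤ[ ζ ] → x ∈ℚ⟨ ζ ⟩
  include gen = gen
  include zero = zero
  include one = one
  include (add p q) = add (include p) (include q)
  include (mul p q) = mul (include p) (include q)
  include (neg p) = neg (include p)
  include (resp e p) = resp e (include p)

record Automorphism (K : Subfield) : Set where
  field
    map : Subfield.Carrier K → Subfield.Carrier K
    isRingIsomorphism : IsRingIsomorphism (Subfield.rawRing K) (Subfield.rawRing K) map

-- Finite-dimensional over ℚ: spanned by finitely many of its elements.
IsNumberField : Subfield → Set
IsNumberField K = ∃[ d ] Σ[ b ∈ Vector ℂ d ] (∀ i → Member (b i)) ×
    (∀ x → Member x → Σ[ r ∈ Vector ℚ d ] x ≈ ∑ (λ i → fromℚ (r i) * b i))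
  where open Subfield K

-- The fixed field of the automorphism group is ℚ; a number field with this property
-- is Galois over ℚ.
IsGaloisOverℚ : Subfield → Set
IsGaloisOverℚ K =
  ∀ (x : Subfield.Carrier K) → (∀ (σ : Automorphism K) → proj₁ (Automorphism.map σ x) ≈ proj₁ x) →
  ∃[ r ] proj₁ x ≈ fromℚ r

⨁ : ∀ {k} → (Fin k → RawRing a ℓ) → RawRing a ℓ
⨁ R = record
  { Carrier = ∀ i → R.Carrier i
  ; _≈_ = λ x y → ∀ i → R._≈_ i (x i) (y i)
  ; _+_ = λ x y i → R._+_ i (x i) (y i)
  ; _*_ = λ x y i → R._*_ i (x i) (y i)
  ; -_ = λ x i → R.-_ i (x i)
  ; 0# = λ i → R.0# i
  ; 1# = λ i → R.1# i
  }
  where module R i = RawRing (R i)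

record ℂˣ : Set where
  constructor unit
  field
    value value⁻¹ : ℂ
    inverseʳ      : value * value⁻¹ ≈ 1#

open ℂˣ using (value)

private
  open import Algebra.Properties.CommutativeSemigroup C.*-commutativeSemigroup using (interchange)

  unit-product : ∀ {x x′ y y′} → x * x′ ≈ 1# → y * y′ ≈ 1# → (x * y) * (x′ * y′) ≈ 1#
  unit-product {x} {x′} {y} {y′} p q =
    C.trans (interchange x y x′ y′) (C.trans (C.*-cong p q) (C.*-identityˡ 1#))

ℂˣ-rawGroup : RawGroup 0ℓ 0ℓ
ℂˣ-rawGroup = record
  { Carrier = ℂˣ
  ; _≈_ = λ z w → value z ≈ value w
  ; _∙_ = λ (unit x x′ p) (unit y y′ q) → unit (x * y) (x′ * y′) (unit-product p q)
  ; ε   = unit 1# 1# (C.*-identityˡ 1#)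
  ; _⁻¹ = λ (unit x x′ p) → unit x′ x (C.trans (C.*-comm x′ x) p)
  }

module _ (G : AbelianGroup a ℓ) where
  private
    module G = AbelianGroup G
    open import Algebra.Properties.AbelianGroup G using (⁻¹-∙-comm; ε⁻¹≈ε)

  record Character : Set (a ⊔ ℓ) where
    field
      hom                 : G.Carrier → ℂˣ
      isGroupHomomorphism : IsGroupHomomorphism G.rawGroup ℂˣ-rawGroup hom

    open IsGroupHomomorphism isGroupHomomorphism public

    eval : G.Carrier → ℂ
    eval x = value (hom x)

  open Character using (hom; eval)

  characterGroup : RawGroup (a ⊔ ℓ) a
  characterGroup = record
    { Carrier = Character
    ; _≈_ = λ χ χ′ → ∀ x → eval χ x ≈ eval χ′ x
    ; _∙_ = λ χ χ′ → record
      { hom = λ x → hom χ x U.∙ hom χ′ x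
      ; isGroupHomomorphism = record
        { isMonoidHomomorphism = record
          { isMagmaHomomorphism = record
            { isRelHomomorphism = record
              { cong = λ x≈y → C.*-cong (⟦⟧-cong χ x≈y) (⟦⟧-cong χ′ x≈y) }
            ; homo = λ x y → C.trans (C.*-cong (homo χ x y) (homo χ′ x y)) (interchange _ _ _ _)
            }
          ; ε-homo = C.trans (C.*-cong (ε-homo χ) (ε-homo χ′)) (C.*-identityˡ 1#)
          }
        ; ⁻¹-homo = λ x → C.*-cong (⁻¹-homo χ x) (⁻¹-homo χ′ x)
        }
      }
    ; ε = record
      { hom = λ _ → U.ε
      ; isGroupHomomorphism = record
        { isMonoidHomomorphism = record
          { isMagmaHomomorphism = record
            { isRelHomomorphism = record { cong = λ _ → C.refl }
            ; homo = λ _ _ → C.sym (C.*-identityˡ 1#)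
            }
          ; ε-homo = C.refl
          }
        ; ⁻¹-homo = λ _ → C.refl
        }
      }
    ; _⁻¹ = λ χ → record
      { hom = λ x → hom χ (x G.⁻¹)
      ; isGroupHomomorphism = record
        { isMonoidHomomorphism = record
          { isMagmaHomomorphism = record
            { isRelHomomorphism = record { cong = λ x≈y → ⟦⟧-cong χ (G.⁻¹-cong x≈y) }
            ; homo = λ x y → C.trans (⟦⟧-cong χ (G.sym (⁻¹-∙-comm x y))) (homo χ (x G.⁻¹) (y G.⁻¹))
            }
          ; ε-homo = C.trans (⟦⟧-cong χ ε⁻¹≈ε) (ε-homo χ)
          }
        ; ⁻¹-homo = λ x → ⁻¹-homo χ (x G.⁻¹)
        }
      }
    }
    where
    module U = RawGroup ℂˣ-rawGroup
    open Character using (⟦⟧-cong; homo; ε-homo; ⁻¹-homo)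

  characterSetoid : Setoid (a ⊔ ℓ) a
  characterSetoid = record
    { Carrier = Character
    ; _≈_ = RawGroup._≈_ characterGroup
    ; isEquivalence = record
      { refl = λ _ → C.refl
      ; sym = λ p x → C.sym (p x)
      ; trans = λ p q x → C.trans (p x) (q x)
      }
    }

  -- χ′ = σ(χ); in particular χ takes its values in K.
  IsImage : (K : Subfield) → Automorphism K → Character → Character → Set a
  IsImage K σ χ χ′ = ∀ x → Σ[ χx∈K ∈ Subfield.Member K (eval χ x) ]
    proj₁ (Automorphism.map σ (eval χ x , χx∈K)) ≈ eval χ′ x

  Conjugate : Character → Character → Set (lsuc 0ℓ ⊔ a)
  Conjugate χ χ′ = Σ[ K ∈ Subfield ] IsNumberField K × IsGaloisOverℚ K ×
    Σ[ σ ∈ Automorphism K ] IsImage K σ χ χ′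

  module _ {n} (χ : Fin n → Character) where

    PairwiseNonConjugate : Pred (Fin n) 0ℓ → Set (lsuc 0ℓ ⊔ a)
    PairwiseNonConjugate S = ∀ {i j} → S i → S j → i ≢ j → ¬ Conjugate (χ i) (χ j)

    IsMaximalNonConjugate : Pred (Fin n) 0ℓ → Set (lsuc 0ℓ ⊔ a)
    IsMaximalNonConjugate S = PairwiseNonConjugate S ×
      (∀ (T : Pred (Fin n) 0ℓ) → PairwiseNonConjugate T → S ⊆ T → T ⊆ S)

  -- The group is enumerated as g₁, …, gₙ.  An element Σ hᵢ gᵢ of a group ring is
  -- represented by its vector (h₁, …, hₙ) of coefficients.
  module _ {n} (g : Inverse (≡.setoid (Fin n)) G.setoid) where
    open Inverse g using (to; from)

    -- (Σ hᵢ gᵢ)(Σ h′ⱼ gⱼ) = Σ hᵢ h′ⱼ (gᵢ gⱼ).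
    groupRing : RawRing b ℓ′ → RawRing b ℓ′
    groupRing R = record
      { Carrier = Vector R.Carrier n
      ; _≈_ = λ h h′ → ∀ i → h i R.≈ h′ i
      ; _+_ = λ h h′ i → h i R.+ h′ i
      ; _*_ = λ h h′ t → sum λ i → sum λ j → coefficient t (to i G.∙ to j) (h i R.* h′ j)
      ; -_ = λ h i → R.- h i
      ; 0# = λ _ → R.0#
      ; 1# = λ t → coefficient t G.ε R.1#
      }
      where
      module R = RawRing R
      sum : Vector R.Carrier n → R.Carrier
      sum = RawMonoidOperations.sum R.+-rawMonoid
      -- The coefficient of gₜ in r x.
      coefficient : Fin n → G.Carrier → R.Carrier → R.Carrier
      coefficient t x r = if does (from x Fin.≟ t) then r else R.0#

    -- Linear extension of a character to ℚG.
    evalℚ : Character → Vector ℚ n → ℂ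
    evalℚ χ h = ∑ λ j → fromℚ (h j) * eval χ (to j)

    characterMatrix : (Fin n → Character) → Matrix n n
    characterMatrix χ i j = eval (χ i) (to j)

{-# OPTIONS --safe #-}

-- A sum S = ∑ v whose entries satisfy vᵢ S = S is n times an idempotent (n the number
-- of entries), and ℂ has no idempotents except 0 and 1; hence S = 0 or every vᵢ is 1.
-- This dichotomy is constructive and takes the place of deciding equality in ℂ.
-- Applied to the powers of a root of unity it shows that the q-th roots of unity are
-- the powers of ζ_q; applied to the rows and columns of the character matrix A it
-- yields the orthogonality relations, once characters are known to separate the
-- elements of G.  Thus A⁻¹ is 1/n times the matrix of the χᵢ(gⱼ⁻¹).
--
-- Automorphisms fix ℤ, so χᵢ(h) = σᵢ(χ_{kᵢ}(h)): the first k values χᵢ(h) determine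
-- all of them, and A⁻¹ recovers h.
module Submission where

open import Defs
open import Algebra.Bundles using (AbelianGroup; CommutativeRing)
open import Algebra.Bundles.Raw using (RawGroup; RawRing)
import Algebra.Definitions.RawMonoid as RawMonoidOperations
open import Algebra.Morphism.Structures using (IsRingMonomorphism; IsRingIsomorphism)
open import Data.Bool.Base using (if_then_else_)
open import Data.Empty using (⊥; ⊥-elim)
open import Data.Fin.Base as Fin using (Fin; toℕ; _↑ˡ_; _↑ʳ_; zero; suc)
import Data.Fin.Properties as Fin
open import Data.Integer.Base as ℤ using (ℤ; +-*-rawRing)
import Data.Integer.Properties as ℤ
open import Data.Nat.Base as ℕ using (ℕ; _<_; zero; suc) renaming (_+_ to _+ℕ_)
import Data.Nat.Properties as ℕ
open import Data.Product.Base using (∃; ∃-syntax; Σ-syntax; _×_; _,_; proj₁; proj₂)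
open import Data.Rational.Base as ℚ using (ℚ; 0ℚ; 1ℚ; ½)
import Data.Rational.Properties as ℚ
open import Data.Rational.Unnormalised.Base as ℚᵘ using (mkℚᵘ)
import Data.Rational.Unnormalised.Properties as ℚᵘ
open import Data.Sum.Base as Sum using (_⊎_; inj₁; inj₂)
import Data.Sum.Effectful.Left as Sumₗ
open import Data.Vec.Functional using (Vector; _++_; take; foldr)
open import Effect.Monad using (RawMonad)
open import Function.Base using (_∘_; case_of_)
open import Function.Bundles using (Inverse)
import Function.Construct.Composition as Composition
import Function.Construct.Symmetry as Symmetry
open import Level using (Level; 0ℓ)
open import Relation.Binary.Bundles using (Setoid)
open import Relation.Binary.PropositionalEquality as ≡ using (_≡_; _≢_; cong; cong₂; subst; setoid)
import Relation.Binary.Reasoning.Setoid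
open import Relation.Nullary using (¬_; yes; no; contradiction; does)
open import Relation.Nullary.Decidable using (decidable-stable)
open import Relation.Nullary.Decidable.Core using (dec⇒maybe)
open import Relation.Nullary.Negation using (¬¬-Monad; ¬¬-map)
open import Tactic.RingSolver.Core.AlmostCommutativeRing using (fromCommutativeRing)
import Tactic.RingSolver.NonReflective as RingSolver
open Inverse using (to)

private
  variable
    a ℓ : Level
    n : ℕ

-- Idempotents of ℝ and ℂ

module ℤ⊂ℚ where
  private
    toℚᵘ : ∀ z → ℚ.toℚᵘ (ℤ⊂ℚ z) ℚᵘ.≃ mkℚᵘ z 0
    toℚᵘ z = ℚ.toℚᵘ-fromℚᵘ (mkℚᵘ z 0)

  +-homo : ∀ x y → ℤ⊂ℚ (x ℤ.+ y) ≡ ℤ⊂ℚ x ℚ.+ ℤ⊂ℚ y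
  +-homo x y = ℚ.toℚᵘ-injective (begin
    ℚ.toℚᵘ (ℤ⊂ℚ (x ℤ.+ y))                      ≈⟨ toℚᵘ (x ℤ.+ y) ⟩
    mkℚᵘ (x ℤ.+ y) 0
      ≈⟨ ℚᵘ.*≡* (cong (ℤ._* ℤ.1ℤ) (cong₂ ℤ._+_ (ℤ.*-identityʳ x) (ℤ.*-identityʳ y))) ⟨
    mkℚᵘ x 0 ℚᵘ.+ mkℚᵘ y 0                      ≈⟨ ℚᵘ.+-cong (toℚᵘ x) (toℚᵘ y) ⟨
    ℚ.toℚᵘ (ℤ⊂ℚ x) ℚᵘ.+ ℚ.toℚᵘ (ℤ⊂ℚ y)          ≈⟨ ℚ.toℚᵘ-homo-+ (ℤ⊂ℚ x) (ℤ⊂ℚ y) ⟨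
    ℚ.toℚᵘ (ℤ⊂ℚ x ℚ.+ ℤ⊂ℚ y)                    ∎)
    where open import Relation.Binary.Reasoning.Setoid ℚᵘ.≃-setoid

  *-homo : ∀ x y → ℤ⊂ℚ (x ℤ.* y) ≡ ℤ⊂ℚ x ℚ.* ℤ⊂ℚ y
  *-homo x y = ℚ.toℚᵘ-injective (begin
    ℚ.toℚᵘ (ℤ⊂ℚ (x ℤ.* y))                      ≈⟨ toℚᵘ (x ℤ.* y) ⟩
    mkℚᵘ x 0 ℚᵘ.* mkℚᵘ y 0                      ≈⟨ ℚᵘ.*-cong (toℚᵘ x) (toℚᵘ y) ⟨
    ℚ.toℚᵘ (ℤ⊂ℚ x) ℚᵘ.* ℚ.toℚᵘ (ℤ⊂ℚ y)          ≈⟨ ℚ.toℚᵘ-homo-* (ℤ⊂ℚ x) (ℤ⊂ℚ y) ⟨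
    ℚ.toℚᵘ (ℤ⊂ℚ x ℚ.* ℤ⊂ℚ y)                    ∎)
    where open import Relation.Binary.Reasoning.Setoid ℚᵘ.≃-setoid

  injective : ∀ {x y} → ℤ⊂ℚ x ≡ ℤ⊂ℚ y → x ≡ y
  injective {x} {y} eq with ℚᵘ.≃-trans (ℚᵘ.≃-sym (toℚᵘ x)) (ℚᵘ.≃-trans (ℚ.toℚᵘ-cong eq) (toℚᵘ y))
  ... | ℚᵘ.*≡* p = ℤ.*-cancelʳ-≡ x y ℤ.1ℤ p

  nonZero : ∀ n .{{_ : ℕ.NonZero n}} → ℚ.NonZero (ℤ⊂ℚ (ℤ.+ n))
  nonZero n@(suc _) = ℚ.≢-nonZero λ n≡0 → case injective {ℤ.+ n} {ℤ.0ℤ} n≡0 of λ ()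

  -- Clears the denominator, so that a rational is reached from integers by one inversion in a
  -- subfield of ℂ.
  *-denominator : ∀ r → r ℚ.* ℤ⊂ℚ (ℚ.↧ r) ≡ ℤ⊂ℚ (ℚ.↥ r)
  *-denominator r@record{} = ℚ.toℚᵘ-injective (begin
    ℚ.toℚᵘ (r ℚ.* ℤ⊂ℚ (ℚ.↧ r))                  ≈⟨ ℚ.toℚᵘ-homo-* r (ℤ⊂ℚ (ℚ.↧ r)) ⟩
    ℚ.toℚᵘ r ℚᵘ.* ℚ.toℚᵘ (ℤ⊂ℚ (ℚ.↧ r))          ≈⟨ ℚᵘ.*-congˡ {ℚ.toℚᵘ r} (toℚᵘ (ℚ.↧ r)) ⟩
    ℚ.toℚᵘ r ℚᵘ.* mkℚᵘ (ℚ.↧ r) 0                ≈⟨ ℚᵘ.*≡* (ℤ.*-assoc (ℚ.↥ r) (ℚ.↧ r) ℤ.1ℤ) ⟩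
    mkℚᵘ (ℚ.↥ r) 0                              ≈⟨ toℚᵘ (ℚ.↥ r) ⟨
    ℚ.toℚᵘ (ℤ⊂ℚ (ℚ.↥ r))                        ∎)
    where open import Relation.Binary.Reasoning.Setoid ℚᵘ.≃-setoid

module _ (R : CommutativeRing 0ℓ 0ℓ) where
  private module R′ = CommutativeRing R

  -- The property that makes the imaginary part of an idempotent vanish. Stating it for `a`
  -- suffices, as the two squares can be exchanged.
  SumsOfSquaresDefinite : Set
  SumsOfSquaresDefinite = ∀ a b → a R′.* a R′.+ b R′.* b R′.≈ R′.0# → a R′.≈ R′.0#

  -- The sum type asks for a decision between the cases; for idempotents this is possible without
  -- deciding equality in general.
  IdempotentsTrivial : Set
  IdempotentsTrivial = ∀ e → e R′.* e R′.≈ e → e R′.≈ R′.0# ⊎ e R′.≈ R′.1#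

module Real where
  open ℝ
  open _≃_
  private
    module ℚ-Solver = RingSolver (fromCommutativeRing ℚ.+-*-commutativeRing (λ x → dec⇒maybe (0ℚ ℚ.≟ x)))
    open ℚ-Solver using (solve; _⊜_; _⊕_; ⊝_)

    ¼ : ℚ
    ¼ = ½ ℚ.* ½

    *-mono-≤ : ∀ {a b c d} → 0ℚ ℚ.≤ b → 0ℚ ℚ.≤ c → a ℚ.≤ b → c ℚ.≤ d → a ℚ.* c ℚ.≤ b ℚ.* d
    *-mono-≤ {b = b} {c} b≥0 c≥0 a≤b c≤d = ℚ.≤-trans
      (ℚ.*-monoʳ-≤-nonNeg c {{ℚ.nonNegative c≥0}} a≤b)
      (ℚ.*-monoˡ-≤-nonNeg b {{ℚ.nonNegative b≥0}} c≤d)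

    *-pos : ∀ {a b} → 0ℚ ℚ.< a → 0ℚ ℚ.< b → 0ℚ ℚ.< a ℚ.* b
    *-pos {a} {b} a>0 b>0 = subst (ℚ._< a ℚ.* b) (ℚ.*-zeroʳ a) (ℚ.*-monoʳ-<-pos a {{ℚ.positive a>0}} b>0)

    x≤∣x∣ : ∀ x → x ℚ.≤ ℚ.∣ x ∣
    x≤∣x∣ x with ℚ.≤-total 0ℚ x
    ... | inj₁ 0≤x = ℚ.≤-reflexive (≡.sym (ℚ.0≤p⇒∣p∣≡p 0≤x))
    ... | inj₂ x≤0 = ℚ.≤-trans x≤0 (ℚ.0≤∣p∣ x)

    0≤x² : ∀ x → 0ℚ ℚ.≤ x ℚ.* x
    0≤x² x with ℚ.≤-total 0ℚ x
    ... | inj₁ 0≤x = subst (ℚ._≤ x ℚ.* x) (ℚ.*-zeroˡ x) (ℚ.*-monoʳ-≤-nonNeg x {{ℚ.nonNegative 0≤x}} 0≤x)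
    ... | inj₂ x≤0 = subst (ℚ._≤ x ℚ.* x) (ℚ.*-zeroˡ x) (ℚ.*-monoʳ-≤-nonPos x {{ℚ.nonPositive x≤0}} x≤0)

  -- Convergence to 0, wrapped in a record so that the sequence stays visible in the type.
  record Null (s : ℕ → ℚ) : Set where
    constructor null
    field small : ∀ ε → 0ℚ ℚ.< ε → ∃ λ N → ∀ m → N ℕ.≤ m → ℚ.∣ s m ∣ ℚ.< ε

  open Null

  -- Against a constant sequence, the condition of `_∼_` on two indices reduces to a condition on
  -- one.
  null⇒≃ : ∀ {x r} → Null (λ m → seq x m ℚ.- r) → x ≃ fromℚᴿ r
  null⇒≃ x-r = same-limit λ ε ε>0 → let N , h = small x-r ε ε>0 in N , λ m _ m≥ _ → h m m≥

  ≃⇒null : ∀ {x y} → x ≃ y → Null (λ m → seq x m ℚ.- seq y m)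
  ≃⇒null x≃y = null λ ε ε>0 → let N , h = limits x≃y ε ε>0 in N , λ m m≥ → h m m m≥ m≥

  null-cong : ∀ {s t : ℕ → ℚ} → (∀ m → s m ≡ t m) → Null s → Null t
  null-cong s≡t s→0 = null λ ε ε>0 → let N , h = small s→0 ε ε>0 in
    N , λ m m≥ → subst (λ r → ℚ.∣ r ∣ ℚ.< ε) (s≡t m) (h m m≥)

  -- If `ε ≤ ∣ s m ∣`, then `s² + t²` is at least `ε²`; so the index from which the sum stays below
  -- `ε²` works for `s` and `ε`.
  null-summand : ∀ (s t : ℕ → ℚ) → Null (λ m → s m ℚ.* s m ℚ.+ t m ℚ.* t m) → Null s
  null-summand s t s²+t²→0 = null λ ε ε>0 →
    let N , h = small s²+t²→0 (ε ℚ.* ε) (*-pos ε>0 ε>0)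
    in N , λ m m≥ → ℚ.≰⇒> λ ε≤∣s∣ → ℚ.<-irrefl ≡.refl (begin-strict
      ε ℚ.* ε                                  ≤⟨ *-mono-≤ (ℚ.0≤∣p∣ (s m)) (ℚ.<⇒≤ ε>0) ε≤∣s∣ ε≤∣s∣ ⟩
      ℚ.∣ s m ∣ ℚ.* ℚ.∣ s m ∣                  ≡⟨ ℚ.∣p*q∣≡∣p∣*∣q∣ (s m) (s m) ⟨
      ℚ.∣ s m ℚ.* s m ∣                        ≡⟨ ℚ.0≤p⇒∣p∣≡p (0≤x² (s m)) ⟩
      s m ℚ.* s m                              ≡⟨ ℚ.+-identityʳ _ ⟨
      s m ℚ.* s m ℚ.+ 0ℚ                       ≤⟨ ℚ.+-monoʳ-≤ (s m ℚ.* s m) (0≤x² (t m)) ⟩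
      s m ℚ.* s m ℚ.+ t m ℚ.* t m              ≤⟨ x≤∣x∣ _ ⟩
      ℚ.∣ s m ℚ.* s m ℚ.+ t m ℚ.* t m ∣        <⟨ h m m≥ ⟩
      ε ℚ.* ε                                  ∎)
    where open ℚ.≤-Reasoning

  -- Once `∣ t m ∣` is at least ¼, a product below `ε * ¼` forces `∣ s m ∣` below `ε`.
  null-factor : ∀ (s t : ℕ → ℚ) N → (∀ m → N ℕ.≤ m → ¼ ℚ.≤ ℚ.∣ t m ∣) → Null (λ m → s m ℚ.* t m) → Null s
  null-factor s t M t≥¼ st→0 = null λ ε ε>0 →
    let N , h = small st→0 (ε ℚ.* ¼) (*-pos ε>0 (ℚ.positive⁻¹ ¼))
    in M ℕ.⊔ N , λ m m≥ → ℚ.≰⇒> λ ε≤∣s∣ → ℚ.<-irrefl ≡.refl (begin-strict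
      ε ℚ.* ¼
        ≤⟨ *-mono-≤ (ℚ.0≤∣p∣ (s m)) (ℚ.nonNegative⁻¹ ¼) ε≤∣s∣ (t≥¼ m (ℕ.m⊔n≤o⇒m≤o M N m≥)) ⟩
      ℚ.∣ s m ∣ ℚ.* ℚ.∣ t m ∣        ≡⟨ ℚ.∣p*q∣≡∣p∣*∣q∣ (s m) (t m) ⟨
      ℚ.∣ s m ℚ.* t m ∣              <⟨ h m (ℕ.m⊔n≤o⇒n≤o M N m≥) ⟩
      ε ℚ.* ¼                        ∎)
    where open ℚ.≤-Reasoning

  -- Carries a lower bound from one term of a Cauchy sequence to all later ones, at the cost of
  -- halving it.
  stays-apart : ∀ x y → ℚ.∣ x ℚ.- y ∣ ℚ.< ¼ → ½ ℚ.≤ ℚ.∣ x ∣ → ¼ ℚ.≤ ℚ.∣ y ∣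
  stays-apart x y close x≥½ = ℚ.≮⇒≥ λ ∣y∣<¼ → ℚ.<-irrefl ≡.refl (begin-strict
    ½                                   ≤⟨ x≥½ ⟩
    ℚ.∣ x ∣                             ≡⟨ cong ℚ.∣_∣ (solve 2 (λ x y → x ⊜ ((x ⊕ (⊝ y)) ⊕ y)) ≡.refl x y) ⟩
    ℚ.∣ (x ℚ.- y) ℚ.+ y ∣               ≤⟨ ℚ.∣p+q∣≤∣p∣+∣q∣ (x ℚ.- y) y ⟩
    -- The bound `¼ + ¼` evaluates to ½.
    ℚ.∣ x ℚ.- y ∣ ℚ.+ ℚ.∣ y ∣           <⟨ ℚ.+-mono-< close ∣y∣<¼ ⟩
    ½                                   ∎)
    where open ℚ.≤-Reasoning

  1-apart : ∀ x → x ℚ.≤ ½ → ½ ℚ.≤ ℚ.∣ x ℚ.- 1ℚ ∣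
  1-apart x x≤½ = begin
    ½                        ≤⟨ ℚ.neg-antimono-≤ (ℚ.+-monoˡ-≤ (ℚ.- 1ℚ) x≤½) ⟩
    ℚ.- (x ℚ.- 1ℚ)           ≤⟨ x≤∣x∣ _ ⟩
    ℚ.∣ ℚ.- (x ℚ.- 1ℚ) ∣     ≡⟨ ℚ.∣-p∣≡∣p∣ (x ℚ.- 1ℚ) ⟩
    ℚ.∣ x ℚ.- 1ℚ ∣           ∎
    where open ℚ.≤-Reasoning

  -- A rational approximation of e tells which of the factors e and e − 1 of 0 is
  -- bounded away from 0.
  null-dichotomy : ∀ (s : ℕ → ℚ) → s Cauchy.∼ s → Null (λ m → s m ℚ.* s m ℚ.- s m) →
                   Null s ⊎ Null (λ m → s m ℚ.- 1ℚ)
  null-dichotomy s cauchy s²-s→0 =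
    -- The decidable comparison of the single rational `s N` with ½ selects the case; all terms from
    -- `N` on lie within ¼ of `s N`.
    let N , close = cauchy ¼ (ℚ.positive⁻¹ ¼)
    in Sum.map
         (λ s≤½ → null-factor s (λ m → s m ℚ.- 1ℚ) N
           (λ m m≥ → stays-apart (s N ℚ.- 1ℚ) (s m ℚ.- 1ℚ)
             (subst (λ r → ℚ.∣ r ∣ ℚ.< ¼) (shift (s N) (s m)) (close N m ℕ.≤-refl m≥)) (1-apart (s N) s≤½))
           (null-cong (λ m → factor (s m)) s²-s→0))
         (λ ½≤s → null-factor (λ m → s m ℚ.- 1ℚ) s N
           (λ m m≥ → stays-apart (s N) (s m) (close N m ℕ.≤-refl m≥) (ℚ.≤-trans ½≤s (x≤∣x∣ (s N))))
           (null-cong (λ m → ≡.trans (factor (s m)) (ℚ.*-comm (s m) (s m ℚ.- 1ℚ))) s²-s→0))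
         (ℚ.≤-total (s N) ½)
    where
    shift : ∀ x y → x ℚ.- y ≡ (x ℚ.- 1ℚ) ℚ.- (y ℚ.- 1ℚ)
    shift x y = solve 3 (λ x y z → (x ⊕ (⊝ y)) ⊜ ((x ⊕ (⊝ z)) ⊕ (⊝ (y ⊕ (⊝ z))))) ≡.refl x y 1ℚ
    factor : ∀ x → x ℚ.* x ℚ.- x ≡ x ℚ.* (x ℚ.- 1ℚ)
    factor x = ≡.trans (cong (λ y → x ℚ.* x ℚ.+ y) (-x≡x*-1 x)) (≡.sym (ℚ.*-distribˡ-+ x x (ℚ.- 1ℚ)))
      where
      -x≡x*-1 : ∀ x → ℚ.- x ≡ x ℚ.* ℚ.- 1ℚ
      -x≡x*-1 x = ≡.trans (cong ℚ.-_ (≡.sym (ℚ.*-identityʳ x))) (ℚ.neg-distribʳ-* x 1ℚ)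

  sumsOfSquaresDefinite : SumsOfSquaresDefinite ℝ-commutativeRing
  sumsOfSquaresDefinite a b sum≃0 = null⇒≃ (null-cong (λ m → ≡.sym (ℚ.+-identityʳ (seq a m)))
    (null-summand (seq a) (seq b)
      (null-cong (λ m → ℚ.+-identityʳ (seq a m ℚ.* seq a m ℚ.+ seq b m ℚ.* seq b m)) (≃⇒null sum≃0))))

  idempotentsTrivial : IdempotentsTrivial ℝ-commutativeRing
  idempotentsTrivial e e²≃e = Sum.map
    (λ e→0 → null⇒≃ (null-cong (λ m → ≡.sym (ℚ.+-identityʳ (seq e m))) e→0))
    null⇒≃
    (null-dichotomy (seq e) (cauchy e) (≃⇒null e²≃e))

  pointwise : ∀ {x y} → (∀ m → seq x m ≡ seq y m) → x ≃ y
  pointwise {x} x≡y = same-limit λ ε ε>0 → let N , close = cauchy x ε ε>0 in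
    N , λ m n m≥ n≥ → subst (λ r → ℚ.∣ seq x m ℚ.- r ∣ ℚ.< ε) (x≡y n) (close m n m≥ n≥)

  -- A positive distance between `x` and `y` could serve as its own `ε`, but constant sequences
  -- never come closer than this distance.
  fromℚᴿ-injective : ∀ {x y} → fromℚᴿ x ≃ fromℚᴿ y → x ≡ y
  fromℚᴿ-injective {x} {y} x≃y = x∙y⁻¹≈ε⇒x≈y x y (ℚ.∣p∣≡0⇒p≡0 (x ℚ.- y) (ℚ.≤-antisym (ℚ.≮⇒≥ λ 0<d →
      let N , p = limits x≃y _ 0<d in ℚ.<-irrefl ≡.refl (p N N ℕ.≤-refl ℕ.≤-refl)) (ℚ.0≤∣p∣ (x ℚ.- y))))
    where open import Algebra.Properties.Group ℚ.+-0-group using (x∙y⁻¹≈ε⇒x≈y)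

module IdempotentR[i] (base : CommutativeRing 0ℓ 0ℓ) where
  open AdjoinI base
  private
    module R = CommutativeRing base
    open import Algebra.Properties.Group R.+-group using (∙-cancelˡ)
    open import Algebra.Solver.Ring.NaturalCoefficients.Default R.commutativeSemiring
    open import Relation.Binary.Reasoning.Setoid R.setoid

    -- y² = (2xy)² = 4 (x + y²) y² = 2y² + 4y⁴, whence y² + (2y²)² = 0.
    sum-of-squares : ∀ x y → x R.* x R.≈ x R.+ y R.* y → x R.* y R.+ y R.* x R.≈ y →
                     y R.* y R.+ (y R.* y R.+ y R.* y) R.* (y R.* y R.+ y R.* y) R.≈ R.0#
    sum-of-squares x y x²≈x+y² 2xy≈y = R.sym (∙-cancelˡ (y R.* y) _ _ (begin
      y R.* y R.+ R.0#
        ≈⟨ R.+-identityʳ _ ⟩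
      y R.* y
        ≈⟨ R.*-cong 2xy≈y 2xy≈y ⟨
      (x R.* y R.+ y R.* x) R.* (x R.* y R.+ y R.* x)
        ≈⟨ solve 2 (λ x y → (x :* y :+ y :* x) :* (x :* y :+ y :* x) := (x :* x) :* ((y :+ y) :* (y :+ y))) R.refl x y ⟩
      (x R.* x) R.* ((y R.+ y) R.* (y R.+ y))
        ≈⟨ R.*-congʳ x²≈x+y² ⟩
      (x R.+ y R.* y) R.* ((y R.+ y) R.* (y R.+ y))
        ≈⟨ solve 2 (λ x y → (x :+ y :* y) :* ((y :+ y) :* (y :+ y))
             := (x :* y :+ y :* x) :* (y :+ y) :+ (y :* y :+ y :* y) :* (y :* y :+ y :* y)) R.refl x y ⟩
      (x R.* y R.+ y R.* x) R.* (y R.+ y) R.+ (y R.* y R.+ y R.* y) R.* (y R.* y R.+ y R.* y)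
        ≈⟨ R.+-congʳ (R.*-congʳ 2xy≈y) ⟩
      y R.* (y R.+ y) R.+ (y R.* y R.+ y R.* y) R.* (y R.* y R.+ y R.* y)
        ≈⟨ solve 1 (λ y → y :* (y :+ y) :+ (y :* y :+ y :* y) :* (y :* y :+ y :* y)
             := y :* y :+ (y :* y :+ (y :* y :+ y :* y) :* (y :* y :+ y :* y))) R.refl y ⟩
      y R.* y R.+ (y R.* y R.+ (y R.* y R.+ y R.* y) R.* (y R.* y R.+ y R.* y)) ∎))

  -- Comparing imaginary parts and using definiteness gives `y ≈ 0`; then the real part `x` is
  -- itself an idempotent of the base ring.
  idempotentsTrivial : SumsOfSquaresDefinite base → IdempotentsTrivial base → IdempotentsTrivial R[i]-commutativeRing
  idempotentsTrivial definite idempotent (x +i y) (x²-y²≈x , 2xy≈y) =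
    Sum.map (λ x≈0 → x≈0 , y≈0) (λ x≈1 → x≈1 , y≈0) (idempotent x (begin
      x R.* x                       ≈⟨ x²≈x+y² ⟩
      x R.+ y R.* y                 ≈⟨ R.+-congˡ (R.trans (R.*-congʳ y≈0) (R.zeroˡ y)) ⟩
      x R.+ R.0#                    ≈⟨ R.+-identityʳ x ⟩
      x                             ∎))
    where
    x²≈x+y² : x R.* x R.≈ x R.+ y R.* y
    x²≈x+y² = begin
      x R.* x                                   ≈⟨ R.+-identityʳ _ ⟨
      x R.* x R.+ R.0#                          ≈⟨ R.+-congˡ (R.-‿inverseˡ (y R.* y)) ⟨
      x R.* x R.+ (R.- (y R.* y) R.+ y R.* y)   ≈⟨ R.+-assoc _ _ _ ⟨
      x R.* x R.- y R.* y R.+ y R.* y           ≈⟨ R.+-congʳ x²-y²≈x ⟩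
      x R.+ y R.* y                             ∎
    y≈0 : y R.≈ R.0#
    y≈0 = definite y (y R.* y R.+ y R.* y) (sum-of-squares x y x²≈x+y² 2xy≈y)

module ℂ = CommutativeRing ℂ-commutativeRing

-- Facts that depend on the construction of ℂ

opaque
  unfolding ℂ-commutativeRing fromℚ

  ℂ-idempotentsTrivial : IdempotentsTrivial ℂ-commutativeRing
  ℂ-idempotentsTrivial =
    IdempotentR[i].idempotentsTrivial ℝ-commutativeRing Real.sumsOfSquaresDefinite Real.idempotentsTrivial

  fromℚ-+ : ∀ x y → fromℚ (x ℚ.+ y) ≈ fromℚ x + fromℚ y
  fromℚ-+ x y = record { re≈ = Real.pointwise λ _ → ≡.refl ; im≈ = Real.pointwise λ _ → ≡.refl }

  fromℚ-* : ∀ x y → fromℚ (x ℚ.* y) ≈ fromℚ x * fromℚ y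
  fromℚ-* x y = record
    { re≈ = Real.pointwise λ _ → ≡.sym (ℚ.+-identityʳ (x ℚ.* y))
    ; im≈ = Real.pointwise λ _ → ≡.sym (cong₂ ℚ._+_ (ℚ.*-zeroʳ x) (ℚ.*-zeroˡ y))
    }

  fromℚ-1 : fromℚ 1ℚ ≈ 1#
  fromℚ-1 = record { re≈ = Real.pointwise λ _ → ≡.refl ; im≈ = Real.pointwise λ _ → ≡.refl }

  fromℚ-0 : fromℚ 0ℚ ≈ 0#
  fromℚ-0 = record { re≈ = Real.pointwise λ _ → ≡.refl ; im≈ = Real.pointwise λ _ → ≡.refl }

  fromℚ-injective : ∀ {x y} → fromℚ x ≈ fromℚ y → x ≡ y
  fromℚ-injective x≈y = Real.fromℚᴿ-injective (AdjoinI._≈ᶜ_.re≈ x≈y)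

open import Algebra.Properties.CommutativeSemigroup ℂ.*-commutativeSemigroup
  using (x∙yz≈y∙xz; interchange)
open import Algebra.Properties.CommutativeSemiring.Exp ℂ.commutativeSemiring
  using (_^_; ^-congˡ; ^-congʳ; ^-assocʳ; ^-distrib-*)
open import Algebra.Properties.Ring ℂ.ring using (-1*x≈-x; -‿distribˡ-*)
open import Algebra.Properties.Semiring.Sum ℂ.semiring
  using (sum-cong-≋; sum-init-last; *-distribˡ-sum; *-distribʳ-sum; ∑-comm; ∑-permute; ∑-distrib-+)
open Relation.Binary.Reasoning.Setoid ℂ.setoid

-- Sums and roots of unity in ℂ

fromℤ-+ : ∀ x y → fromℤ (x ℤ.+ y) ≈ fromℤ x + fromℤ y
fromℤ-+ x y = ℂ.trans (ℂ.reflexive (cong fromℚ (ℤ⊂ℚ.+-homo x y))) (fromℚ-+ (ℤ⊂ℚ x) (ℤ⊂ℚ y))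

fromℤ-* : ∀ x y → fromℤ (x ℤ.* y) ≈ fromℤ x * fromℤ y
fromℤ-* x y = ℂ.trans (ℂ.reflexive (cong fromℚ (ℤ⊂ℚ.*-homo x y))) (fromℚ-* (ℤ⊂ℚ x) (ℤ⊂ℚ y))

fromℤ-neg : ∀ x → fromℤ (ℤ.- x) ≈ - fromℤ x
fromℤ-neg x = inverseʳ-unique (fromℤ x) (fromℤ (ℤ.- x)) (begin
  fromℤ x + fromℤ (ℤ.- x)  ≈⟨ fromℤ-+ x (ℤ.- x) ⟨
  fromℤ (x ℤ.- x)          ≈⟨ ℂ.reflexive (cong fromℤ (ℤ.+-inverseʳ x)) ⟩
  fromℤ ℤ.0ℤ               ≈⟨ fromℚ-0 ⟩
  0#                       ∎)
  where open import Algebra.Properties.Group ℂ.+-group using (inverseʳ-unique)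

fromℤ-injective : ∀ {x y} → fromℤ x ≈ fromℤ y → x ≡ y
fromℤ-injective = ℤ⊂ℚ.injective ∘ fromℚ-injective

ι : ℕ → ℂ
ι n = fromℤ (ℤ.+ n)

ι-suc : ∀ n → ι (suc n) ≈ 1# + ι n
ι-suc n = ℂ.trans (fromℤ-+ (ℤ.+ 1) (ℤ.+ n)) (ℂ.+-congʳ fromℚ-1)

ι-injective : ∀ {m n} → ι m ≈ ι n → m ≡ n
ι-injective = ℤ.+-injective ∘ fromℤ-injective

-- Inverts in ℚ and embeds the result, since ℂ is given only as a commutative ring.
reciprocal : ∀ n .{{_ : ℕ.NonZero n}} → ℂ
reciprocal n = fromℚ ((ℚ.1/ ℤ⊂ℚ (ℤ.+ n)) {{ℤ⊂ℚ.nonZero n}})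

ι*reciprocal : ∀ n .{{_ : ℕ.NonZero n}} → ι n * reciprocal n ≈ 1#
ι*reciprocal n = ℂ.trans (ℂ.sym (fromℚ-* (ℤ⊂ℚ (ℤ.+ n)) _))
  (ℂ.trans (ℂ.reflexive (cong fromℚ (ℚ.*-inverseʳ (ℤ⊂ℚ (ℤ.+ n)) {{ℤ⊂ℚ.nonZero n}}))) fromℚ-1)

reciprocal-cancel : ∀ n .{{_ : ℕ.NonZero n}} x → ι n * (reciprocal n * x) ≈ x
reciprocal-cancel n x =
  ℂ.trans (ℂ.sym (ℂ.*-assoc (ι n) (reciprocal n) x)) (ℂ.trans (ℂ.*-congʳ (ι*reciprocal n)) (ℂ.*-identityˡ x))

∑-zero : ∀ {n} {f : Vector ℂ n} → (∀ i → f i ≈ 0#) → ∑ f ≈ 0#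
∑-zero {zero}  f≈0 = ℂ.refl
∑-zero {suc n} f≈0 = ℂ.trans (ℂ.+-cong (f≈0 zero) (∑-zero (f≈0 ∘ suc))) (ℂ.+-identityˡ 0#)

∑-single : ∀ {n} (f : Vector ℂ n) i → (∀ j → j ≢ i → f j ≈ 0#) → ∑ f ≈ f i
∑-single f zero    f≈0 = ℂ.trans (ℂ.+-congˡ (∑-zero (λ j → f≈0 (suc j) λ ()))) (ℂ.+-identityʳ (f zero))
∑-single f (suc i) f≈0 = ℂ.trans
  (ℂ.+-cong (f≈0 zero λ ()) (∑-single (f ∘ suc) i λ j j≢i → f≈0 (suc j) (j≢i ∘ Fin.suc-injective)))
  (ℂ.+-identityˡ (f (suc i)))

∑-const : ∀ n x → ∑ {n} (λ _ → x) ≈ ι n * x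
∑-const zero    x = ℂ.sym (ℂ.trans (ℂ.*-congʳ fromℚ-0) (ℂ.zeroˡ x))
∑-const (suc n) x = begin
  x + ∑ {n} (λ _ → x)   ≈⟨ ℂ.+-cong (ℂ.sym (ℂ.*-identityˡ x)) (∑-const n x) ⟩
  1# * x + ι n * x      ≈⟨ ℂ.distribʳ x 1# (ι n) ⟨
  (1# + ι n) * x        ≈⟨ ℂ.*-congʳ (ι-suc n) ⟨
  ι (suc n) * x         ∎

∑-ones : ∀ {n} {f : Vector ℂ n} → (∀ i → f i ≈ 1#) → ∑ f ≈ ι n
∑-ones {n} f≈1 = ℂ.trans (sum-cong-≋ f≈1) (ℂ.trans (∑-const n 1#) (ℂ.*-identityʳ (ι n)))

-- The mean of v is idempotent.
invariant-sum : ∀ {n} .{{_ : ℕ.NonZero n}} (v : Vector ℂ n) → (∀ i → v i * ∑ v ≈ ∑ v) →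
                ∑ v ≈ 0# ⊎ (∀ i → v i ≈ 1#)
invariant-sum {n} v invariant = Sum.map mean≈0 mean≈1 (ℂ-idempotentsTrivial mean mean²≈mean)
  where
  mean = reciprocal n * ∑ v
  -- The equations vᵢ S = S are summed over i.
  ∑v*∑v : ∑ v * ∑ v ≈ ι n * ∑ v
  ∑v*∑v = ℂ.trans (*-distribʳ-sum (∑ v) v) (ℂ.trans (sum-cong-≋ invariant) (∑-const n (∑ v)))
  mean²≈mean : mean * mean ≈ mean
  mean²≈mean = begin
    (reciprocal n * ∑ v) * (reciprocal n * ∑ v)    ≈⟨ interchange _ _ _ _ ⟩
    (reciprocal n * reciprocal n) * (∑ v * ∑ v)    ≈⟨ ℂ.*-congˡ ∑v*∑v ⟩
    (reciprocal n * reciprocal n) * (ι n * ∑ v)    ≈⟨ ℂ.*-assoc _ _ _ ⟩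
    reciprocal n * (reciprocal n * (ι n * ∑ v))    ≈⟨ ℂ.*-congˡ (x∙yz≈y∙xz _ _ _) ⟩
    reciprocal n * (ι n * (reciprocal n * ∑ v))    ≈⟨ ℂ.*-congˡ (reciprocal-cancel n (∑ v)) ⟩
    reciprocal n * ∑ v                             ∎
  mean≈0 : mean ≈ 0# → ∑ v ≈ 0#
  mean≈0 eq = begin
    ∑ v                 ≈⟨ reciprocal-cancel n (∑ v) ⟨
    ι n * mean          ≈⟨ ℂ.*-congˡ eq ⟩
    ι n * 0#            ≈⟨ ℂ.zeroʳ (ι n) ⟩
    0#                  ∎
  -- Multiplication by vᵢ fixes the mean as it fixes the sum; a mean of 1 therefore gives vᵢ = 1.
  mean≈1 : mean ≈ 1# → ∀ i → v i ≈ 1#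
  mean≈1 eq i = begin
    v i                           ≈⟨ ℂ.*-identityʳ (v i) ⟨
    v i * 1#                      ≈⟨ ℂ.*-congˡ eq ⟨
    v i * (reciprocal n * ∑ v)    ≈⟨ x∙yz≈y∙xz _ _ _ ⟩
    reciprocal n * (v i * ∑ v)    ≈⟨ ℂ.*-congˡ (invariant i) ⟩
    mean                          ≈⟨ eq ⟩
    1#                            ∎

1^n≈1 : ∀ n → 1# ^ n ≈ 1#
1^n≈1 zero    = ℂ.refl
1^n≈1 (suc n) = ℂ.trans (ℂ.*-identityˡ (1# ^ n)) (1^n≈1 n)

^-comm : ∀ x m n → (x ^ m) ^ n ≈ (x ^ n) ^ m
^-comm x m n = ℂ.trans (^-assocʳ x m n) (ℂ.trans (^-congʳ x (ℕ.*-comm m n)) (ℂ.sym (^-assocʳ x n m)))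

^-root : ∀ {x} m n → x ^ n ≈ 1# → (x ^ m) ^ n ≈ 1#
^-root {x} m n x^n≈1 = ℂ.trans (^-comm x m n) (ℂ.trans (^-congˡ m x^n≈1) (1^n≈1 m))

-- Summing w, …, w^q rather than 1, …, w^(q−1) makes w itself one of the summands.
powerSum : ℕ → ℂ → ℂ
powerSum q w = ∑ λ (i : Fin q) → w ^ suc (toℕ i)

-- Multiplication by `w` shifts the summands cyclically: the last one becomes `w ^ (q + 1)`, which
-- is the first summand `w`.
powerSum-invariant : ∀ p {w} → w ^ suc p ≈ 1# → w * powerSum (suc p) w ≈ powerSum (suc p) w
powerSum-invariant p {w} w^q≈1 = begin
  w * powerSum (suc p) w                                   ≈⟨ *-distribˡ-sum {suc p} w (λ i → w ^ suc (toℕ i)) ⟩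
  ∑ (λ (i : Fin (suc p)) → w ^ suc (suc (toℕ i)))          ≈⟨ sum-init-last {p} (λ i → w ^ suc (suc (toℕ i))) ⟩
  ∑ (λ (i : Fin p) → w ^ suc (suc (toℕ (Fin.inject₁ i)))) + w * w ^ suc (toℕ (Fin.fromℕ p))
    ≈⟨ ℂ.+-cong (sum-cong-≋ {p} λ i → ^-congʳ w (cong (λ m → suc (suc m)) (Fin.toℕ-inject₁ i)))
                (ℂ.*-congˡ (ℂ.trans (^-congʳ w (cong suc (Fin.toℕ-fromℕ p))) w^q≈1)) ⟩
  ∑ (λ (i : Fin p) → w ^ suc (suc (toℕ i))) + w ^ 1        ≈⟨ ℂ.+-comm _ _ ⟩
  powerSum (suc p) w                                       ∎

-- With `w`, each of its powers fixes the power sum, so `invariant-sum` applies; in its second case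
-- the first summand, `w` itself, is 1.
powerSum≈0∨≈1 : ∀ p {w} → w ^ suc p ≈ 1# → powerSum (suc p) w ≈ 0# ⊎ w ≈ 1#
powerSum≈0∨≈1 p {w} w^q≈1 = Sum.map₂ (λ w^i≈1 → ℂ.trans (ℂ.sym (ℂ.*-identityʳ w)) (w^i≈1 zero))
  (invariant-sum {suc p} (λ i → w ^ suc (toℕ i)) (λ i → invariant (suc (toℕ i))))
  where
  invariant : ∀ m → w ^ m * powerSum (suc p) w ≈ powerSum (suc p) w
  invariant zero    = ℂ.*-identityˡ _
  invariant (suc m) = ℂ.trans (ℂ.*-assoc w (w ^ m) _) (ℂ.trans (ℂ.*-congˡ (invariant m)) (powerSum-invariant p w^q≈1))

-- If no z ζ^j were 1, then Σⱼ Σₘ (z ζ^j)^m would vanish; but summing over j first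
-- leaves only the terms with m = q, whose sum is q.
root∈ℤ[ζ] : ∀ {q ζ z} → IsPrimitiveRoot q ζ → z ^ q ≈ 1# → z ∈ℤ[ ζ ]
root∈ℤ[ζ] {suc p} {ζ} {z} (_ , ζ^q≈1 , ζ-primitive) z^q≈1 =
  Sum.[ (λ (j , zζ^j≈1) → resp (inverse j zζ^j≈1) (power (suc (toℕ j)) p)) , (λ sums≈0 → ⊥-elim (absurd sums≈0)) ]′
  -- Traversing all j either yields one with z ζ^j = 1 or collects proofs that all the power sums
  -- vanish.
  (Fin.sequence (Sumₗ.applicative (∃[ j ] z * ζ ^ suc (toℕ j) ≈ 1#) 0ℓ)
    (λ j → Sum.map₁ (j ,_) (Sum.swap (powerSum≈0∨≈1 p {z * ζ ^ suc (toℕ j)} (root j)))))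
  where
  q = suc p
  power : ∀ m n → ((ζ ^ m) ^ n) ∈ℤ[ ζ ]
  power m n = closed (closed gen m) n
    where
    closed : ∀ {x} → x ∈ℤ[ ζ ] → ∀ m → (x ^ m) ∈ℤ[ ζ ]
    closed x∈ zero    = one
    closed x∈ (suc m) = mul x∈ (closed x∈ m)
  root : ∀ (j : Fin q) → (z * ζ ^ suc (toℕ j)) ^ q ≈ 1#
  root j = ℂ.trans (^-distrib-* z (ζ ^ suc (toℕ j)) q)
    (ℂ.trans (ℂ.*-cong z^q≈1 (^-root (suc (toℕ j)) q ζ^q≈1)) (ℂ.*-identityˡ 1#))
  -- Since ζ^j is a q-th root of unity, its inverse `z` is its power with exponent `p`, that is q -
  -- 1; this exhibits `z` as a power of ζ.
  inverse : ∀ (j : Fin q) → z * ζ ^ suc (toℕ j) ≈ 1# → (ζ ^ suc (toℕ j)) ^ p ≈ z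
  inverse j zζ^j≈1 = begin
    y ^ p            ≈⟨ ℂ.*-identityˡ _ ⟨
    1# * y ^ p       ≈⟨ ℂ.*-congʳ zζ^j≈1 ⟨
    (z * y) * y ^ p  ≈⟨ ℂ.*-assoc z y (y ^ p) ⟩
    z * y ^ q        ≈⟨ ℂ.*-congˡ (^-root (suc (toℕ j)) q ζ^q≈1) ⟩
    z * 1#           ≈⟨ ℂ.*-identityʳ z ⟩
    z                ∎
    where y = ζ ^ suc (toℕ j)
  column : ∀ (m : Fin q) → ∑ (λ (j : Fin q) → (z * ζ ^ suc (toℕ j)) ^ suc (toℕ m)) ≈
           z ^ suc (toℕ m) * powerSum q (ζ ^ suc (toℕ m))
  column m = begin
    ∑ (λ (j : Fin q) → (z * ζ ^ suc (toℕ j)) ^ m′)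
      ≈⟨ sum-cong-≋ {q} (λ j → ℂ.trans (^-distrib-* z (ζ ^ suc (toℕ j)) m′) (ℂ.*-congˡ (^-comm ζ (suc (toℕ j)) m′))) ⟩
    ∑ (λ (j : Fin q) → z ^ m′ * (ζ ^ m′) ^ suc (toℕ j))
      ≈⟨ *-distribˡ-sum {q} (z ^ m′) (λ j → (ζ ^ m′) ^ suc (toℕ j)) ⟨
    z ^ m′ * powerSum q (ζ ^ m′)                           ∎
    where m′ = suc (toℕ m)
  absurd : (∀ (j : Fin q) → powerSum q (z * ζ ^ suc (toℕ j)) ≈ 0#) → ⊥
  absurd sums≈0 = case ι-injective {q} {0} (begin
    ι q                                     ≈⟨ ∑-ones {q} (λ i → 1^n≈1 (suc (toℕ i))) ⟨
    powerSum q 1#                           ≈⟨ sum-cong-≋ {q} (λ j → ^-congˡ (suc (toℕ j)) ζ^q≈1) ⟨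
    powerSum q (ζ ^ q)                      ≈⟨ ℂ.*-identityˡ _ ⟨
    1# * powerSum q (ζ ^ q)                 ≈⟨ ℂ.*-congʳ z^q≈1 ⟨
    z ^ q * powerSum q (ζ ^ q)
      ≈⟨ ℂ.reflexive (cong (λ m → z ^ suc m * powerSum q (ζ ^ suc m)) (Fin.toℕ-fromℕ p)) ⟨
    term (Fin.fromℕ p)
      ≈⟨ ∑-single term (Fin.fromℕ p) (λ m m≢p → ℂ.trans (ℂ.*-congˡ (vanishes m m≢p)) (ℂ.zeroʳ _)) ⟨
    ∑ term                                  ≈⟨ sum-cong-≋ {q} column ⟨
    ∑ (λ (m : Fin q) → ∑ λ (j : Fin q) → (z * ζ ^ suc (toℕ j)) ^ suc (toℕ m))
      ≈⟨ ∑-comm {q} {q} (λ m j → (z * ζ ^ suc (toℕ j)) ^ suc (toℕ m)) ⟩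
    ∑ (λ (j : Fin q) → powerSum q (z * ζ ^ suc (toℕ j))) ≈⟨ ∑-zero {q} sums≈0 ⟩
    0#                                      ≈⟨ fromℚ-0 ⟨
    ι 0                                     ∎) of λ ()
    where
    term : Vector ℂ q
    term m = z ^ suc (toℕ m) * powerSum q (ζ ^ suc (toℕ m))
    -- The exponents `suc (toℕ m)` run from 1 to q, and q occurs only at the last index; at the
    -- others primitivity excludes ζ^m = 1.
    vanishes : ∀ m → m ≢ Fin.fromℕ p → powerSum q (ζ ^ suc (toℕ m)) ≈ 0#
    vanishes m m≢p = Sum.fromInj₁ (λ ζ^m≈1 → contradiction ζ^m≈1 (ζ-primitive (suc (toℕ m)) (ℕ.s≤s ℕ.z≤n)
        (ℕ.s≤s (ℕ.≤∧≢⇒< (ℕ.s≤s⁻¹ (Fin.toℕ<n m)) λ m≡p → m≢p (Fin.toℕ-injective (≡.trans m≡p (≡.sym (Fin.toℕ-fromℕ p))))))))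
      (powerSum≈0∨≈1 p (^-root (suc (toℕ m)) q ζ^q≈1))

-- Orthogonality of characters

sumℕ : Vector ℕ n → ℕ
sumℕ = foldr ℕ._+_ 0

ι-sum : (b : Vector ℕ n) → ι (sumℕ b) ≈ ∑ (ι ∘ b)
ι-sum {zero}  b = fromℚ-0
ι-sum {suc n} b = ℂ.trans (fromℤ-+ (ℤ.+ b zero) (ℤ.+ sumℕ (b ∘ suc))) (ℂ.+-congˡ (ι-sum (b ∘ suc)))

entry≤sumℕ : (b : Vector ℕ n) → ∀ i → b i ℕ.≤ sumℕ b
entry≤sumℕ b zero    = ℕ.m≤m+n (b zero) _
entry≤sumℕ b (suc i) = ℕ.≤-trans (entry≤sumℕ (b ∘ suc) i) (ℕ.m≤n+m _ (b zero))

-- Two entries 1 at different places would make the sum at least 2. This will identify the index of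
-- an element on which all characters are trivial with that of the identity.
sumℕ≡1⇒unique : (b : Vector ℕ n) → sumℕ b ≡ 1 → ∀ {i j} → b i ≡ 1 → b j ≡ 1 → i ≡ j
sumℕ≡1⇒unique b Σb≡1 {zero}  {zero}  bᵢ≡1 bⱼ≡1 = ≡.refl
sumℕ≡1⇒unique b Σb≡1 {suc i} {zero}  bᵢ≡1 bⱼ≡1 = ≡.sym (sumℕ≡1⇒unique b Σb≡1 {zero} {suc i} bⱼ≡1 bᵢ≡1)
sumℕ≡1⇒unique b Σb≡1 {zero}  {suc j} bᵢ≡1 bⱼ≡1 =
  contradiction (ℕ.+-mono-≤ (ℕ.≤-reflexive (≡.sym bᵢ≡1)) (ℕ.≤-trans (ℕ.≤-reflexive (≡.sym bⱼ≡1)) (entry≤sumℕ (b ∘ suc) j)))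
    (ℕ.<⇒≱ (ℕ.s≤s (ℕ.≤-reflexive Σb≡1)))
sumℕ≡1⇒unique b Σb≡1 {suc i} {suc j} bᵢ≡1 bⱼ≡1 with b zero in b₀
... | zero  = cong suc (sumℕ≡1⇒unique (b ∘ suc) Σb≡1 bᵢ≡1 bⱼ≡1)
-- A positive first entry already uses up the sum 1, so the remaining entries add up to 0, against
-- the entry 1 among them.
... | suc _ = contradiction (≡.subst₂ ℕ._≤_ bᵢ≡1 (ℕ.m+n≡0⇒n≡0 _ (ℕ.suc-injective Σb≡1)) (entry≤sumℕ (b ∘ suc) i)) λ ()

-- Conjugating `π` by the enumeration `e` gives a permutation of the indices. Elements are recovered
-- only up to the equality of `S`, so `f` has to respect it.
∑-bijection : ∀ {S : Setoid a ℓ} (e : Inverse (≡.setoid (Fin n)) S) (π : Inverse S S)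
              (f : Setoid.Carrier S → ℂ) → (∀ {x y} → Setoid._≈_ S x y → f x ≈ f y) →
              ∑ (λ i → f (Inverse.to π (Inverse.to e i))) ≈ ∑ (λ i → f (Inverse.to e i))
∑-bijection {n = n} e π f f-cong = ℂ.trans
  (sum-cong-≋ {n} (λ i → ℂ.sym (f-cong (Inverse.strictlyInverseˡ e (Inverse.to π (Inverse.to e i))))))
  (ℂ.sym (∑-permute (λ i → f (Inverse.to e i)) (Composition.inverse (Composition.inverse e π) (Symmetry.inverse e))))

ι*-cancelˡ : ∀ n .{{_ : ℕ.NonZero n}} {x y} → ι n * x ≈ ι n * y → x ≈ y
ι*-cancelˡ n {x} {y} nx≈ny = begin
  x                            ≈⟨ reciprocal-cancel n x ⟨
  ι n * (reciprocal n * x)     ≈⟨ x∙yz≈y∙xz _ _ _ ⟩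
  reciprocal n * (ι n * x)     ≈⟨ ℂ.*-congˡ nx≈ny ⟩
  reciprocal n * (ι n * y)     ≈⟨ x∙yz≈y∙xz _ _ _ ⟩
  ι n * (reciprocal n * y)     ≈⟨ reciprocal-cancel n y ⟩
  y                            ∎

module CharacterProperties (G : AbelianGroup a ℓ) where
  private
    module G = AbelianGroup G
    module Ĝ = RawGroup (characterGroup G)
  open Character {G = G} public using (eval)
  open import Algebra.Properties.Group G.group using (x∙y⁻¹≈ε⇒x≈y; \\-leftDividesˡ; \\-leftDividesʳ)

  eval-cong : ∀ χ {x y} → x G.≈ y → eval χ x ≈ eval χ y
  eval-cong χ = Character.⟦⟧-cong χ

  eval-∙ : ∀ χ x y → eval χ (x G.∙ y) ≈ eval χ x * eval χ y
  eval-∙ χ = Character.homo χ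

  eval-ε : ∀ χ → eval χ G.ε ≈ 1#
  eval-ε χ = Character.ε-homo χ

  eval-inverse : ∀ χ x → eval χ x * eval χ (x G.⁻¹) ≈ 1#
  eval-inverse χ x = ℂ.trans (ℂ.sym (eval-∙ χ x (x G.⁻¹))) (ℂ.trans (eval-cong χ (G.inverseʳ x)) (eval-ε χ))

  eval-cancel : ∀ χ x z → eval χ x * (eval χ (x G.⁻¹) * z) ≈ z
  eval-cancel χ x z = ℂ.trans (ℂ.sym (ℂ.*-assoc _ _ z)) (ℂ.trans (ℂ.*-congʳ (eval-inverse χ x)) (ℂ.*-identityˡ z))

  eval-cancel′ : ∀ χ x z → eval χ (x G.⁻¹) * (eval χ x * z) ≈ z
  eval-cancel′ χ x z = ℂ.trans (x∙yz≈y∙xz _ _ z) (eval-cancel χ x z)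

  -- Powers in the character group are computed pointwise.
  order⇒root : ∀ {χ q} → HasOrder Ĝ.rawMonoid χ q → ∀ x → eval χ x ^ q ≈ 1#
  order⇒root {χ} {q} (_ , χ^q≈ε , _) x = ℂ.trans (ℂ.sym (eval-pow q)) (χ^q≈ε x)
    where
    open import Algebra.Definitions.RawMonoid Ĝ.rawMonoid using () renaming (_×_ to pow)
    eval-pow : ∀ m → eval (pow m χ) x ≈ eval χ x ^ m
    eval-pow zero    = ℂ.refl
    eval-pow (suc m) = ℂ.*-congˡ (eval-pow m)

  -- This bijection and `multiplication` reindex the row sums and the column sums of the character
  -- matrix.
  translation : G.Carrier → Inverse G.setoid G.setoid
  translation x = record
    { to        = x G.∙_
    ; from      = x G.⁻¹ G.∙_
    ; to-cong   = G.∙-congˡ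
    ; from-cong = G.∙-congˡ
    ; inverse   = (λ {y} z≈ → G.trans (G.∙-congˡ z≈) (\\-leftDividesˡ x y))
                , (λ {y} z≈ → G.trans (G.∙-congˡ z≈) (\\-leftDividesʳ x y))
    }

  multiplication : Character G → Inverse (characterSetoid G) (characterSetoid G)
  multiplication χ = record
    { to        = χ Ĝ.∙_
    ; from      = χ Ĝ.⁻¹ Ĝ.∙_
    ; to-cong   = λ p x → ℂ.*-congˡ (p x)
    ; from-cong = λ p x → ℂ.*-congˡ (p x)
    ; inverse   = (λ p x → ℂ.trans (ℂ.*-congˡ (p x)) (eval-cancel χ x _))
                , (λ p x → ℂ.trans (ℂ.*-congˡ (p x)) (eval-cancel′ χ x _))
    }

  quotient≈1⇒≈ : ∀ {χ χ′} → (∀ x → eval (χ Ĝ.∙ χ′ Ĝ.⁻¹) x ≈ 1#) → χ Ĝ.≈ χ′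
  quotient≈1⇒≈ {χ} {χ′} trivial x = begin
    eval χ x                                      ≈⟨ eval-cancel χ′ x _ ⟨
    eval χ′ x * (eval χ′ (x G.⁻¹) * eval χ x)     ≈⟨ ℂ.*-congˡ (ℂ.*-comm _ _) ⟩
    eval χ′ x * (eval χ x * eval χ′ (x G.⁻¹))     ≈⟨ ℂ.*-congˡ (trivial x) ⟩
    eval χ′ x * 1#                                ≈⟨ ℂ.*-identityʳ _ ⟩
    eval χ′ x                                     ∎

  module Orthogonality {n} (g : Inverse (≡.setoid (Fin n)) G.setoid)
                       (χ : Inverse (≡.setoid (Fin n)) (characterSetoid G)) where
    private
      module g = Inverse g
      module χ = Inverse χ
      instance
        n≢0 : ℕ.NonZero n
        -- The identity of `G` has an index, so `n` is not 0.
        n≢0 = Fin.nonZeroIndex (g.from G.ε)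

    g-injective : ∀ {i j} → g.to i G.≈ g.to j → i ≡ j
    g-injective {i} {j} eq = ≡.trans (≡.sym (g.strictlyInverseʳ i)) (≡.trans (g.from-cong eq) (g.strictlyInverseʳ j))

    χ-injective : ∀ {i j} → χ.to i Ĝ.≈ χ.to j → i ≡ j
    χ-injective {i} {j} eq = ≡.trans (≡.sym (χ.strictlyInverseʳ i)) (≡.trans (χ.from-cong eq) (χ.strictlyInverseʳ j))

    rowSum : Character G → ℂ
    rowSum ψ = ∑ λ j → eval ψ (g.to j)

    columnSum : G.Carrier → ℂ
    columnSum x = ∑ λ i → eval (χ.to i) x

    -- Multiplying the sum by one of its terms translates the argument of `ψ`, which only permutes
    -- the summands; `invariant-sum` then decides.
    rowSum≈0∨trivial : ∀ ψ → rowSum ψ ≈ 0# ⊎ (∀ x → eval ψ x ≈ 1#)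
    rowSum≈0∨trivial ψ = Sum.map₂
      (λ ψ≈1 x → ℂ.trans (eval-cong ψ (G.sym (g.strictlyInverseˡ x))) (ψ≈1 (g.from x)))
      (invariant-sum (λ j → eval ψ (g.to j)) λ i → begin
        eval ψ (g.to i) * rowSum ψ                       ≈⟨ *-distribˡ-sum (eval ψ (g.to i)) (λ j → eval ψ (g.to j)) ⟩
        ∑ (λ j → eval ψ (g.to i) * eval ψ (g.to j))      ≈⟨ sum-cong-≋ (λ j → eval-∙ ψ (g.to i) (g.to j)) ⟨
        ∑ (λ j → eval ψ (g.to i G.∙ g.to j))
          ≈⟨ ∑-bijection g (translation (g.to i)) (eval ψ) (eval-cong ψ) ⟩
        rowSum ψ                                         ∎)

    -- Dual to the row case: multiplying by a term permutes the characters. As every `ψ` is some χᵢ,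
    -- the second case covers all characters.
    columnSum≈0∨trivial : ∀ x → columnSum x ≈ 0# ⊎ (∀ ψ → eval ψ x ≈ 1#)
    columnSum≈0∨trivial x = Sum.map₂
      (λ ψ≈1 ψ → ℂ.trans (ℂ.sym (χ.strictlyInverseˡ ψ x)) (ψ≈1 (χ.from ψ)))
      (invariant-sum (λ i → eval (χ.to i) x) λ i → begin
        eval (χ.to i) x * columnSum x                    ≈⟨ *-distribˡ-sum (eval (χ.to i) x) (λ j → eval (χ.to j) x) ⟩
        ∑ (λ j → eval (χ.to i Ĝ.∙ χ.to j) x)
          ≈⟨ ∑-bijection χ (multiplication (χ.to i)) (λ ψ → eval ψ x) (λ ψ≈ψ′ → ψ≈ψ′ x) ⟩
        columnSum x                                      ∎)

    -- Each column sum is n times a natural number, and these numbers add up to 1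
    -- since only the trivial character has a nonzero row sum.
    trivial⇒≈ε : ∀ x → (∀ ψ → eval ψ x ≈ 1#) → x G.≈ G.ε
    trivial⇒≈ε x x-trivial = G.trans (G.sym (g.strictlyInverseˡ x))
      (G.trans (G.reflexive (cong g.to same-index)) (g.strictlyInverseˡ G.ε))
      where
      multiplicity : ∀ y → ∃[ m ] columnSum y ≈ ι n * ι m
      multiplicity y = Sum.[ (λ ≈0 → 0 , ℂ.trans ≈0 (ℂ.sym (ℂ.trans (ℂ.*-congˡ fromℚ-0) (ℂ.zeroʳ (ι n)))))
                           , (λ y-trivial → 1 , ℂ.trans (∑-ones (y-trivial ∘ χ.to))
                               (ℂ.sym (ℂ.trans (ℂ.*-congˡ fromℚ-1) (ℂ.*-identityʳ (ι n)))))
                           ]′ (columnSum≈0∨trivial y)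
      b : Vector ℕ n
      b t = proj₁ (multiplicity (g.to t))
      -- `b` records whichever case the dichotomy returned. If all characters are trivial at `y`,
      -- the column sum is n, and cancelling n forces the recorded number to be 1.
      b≡1 : ∀ y → (∀ ψ → eval ψ y ≈ 1#) → b (g.from y) ≡ 1
      b≡1 y y-trivial = ι-injective (ι*-cancelˡ n (begin
        ι n * ι (b (g.from y))           ≈⟨ proj₂ (multiplicity (g.to (g.from y))) ⟨
        columnSum (g.to (g.from y))
          ≈⟨ ∑-ones (λ i → ℂ.trans (eval-cong (χ.to i) (g.strictlyInverseˡ y)) (y-trivial (χ.to i))) ⟩
        ι n                              ≈⟨ ℂ.*-identityʳ (ι n) ⟨
        ι n * 1#                         ≈⟨ ℂ.*-congˡ fromℚ-1 ⟨
        ι n * ι 1                        ∎))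
      i₀ : Fin n
      i₀ = χ.from Ĝ.ε
      rowSum≈0 : ∀ i → i ≢ i₀ → rowSum (χ.to i) ≈ 0#
      rowSum≈0 i i≢i₀ = Sum.fromInj₁
        (λ χᵢ≈1 → contradiction (≡.trans (≡.sym (χ.strictlyInverseʳ i)) (χ.from-cong χᵢ≈1)) i≢i₀)
        (rowSum≈0∨trivial (χ.to i))
      Σb≡1 : sumℕ b ≡ 1
      Σb≡1 = ι-injective (ι*-cancelˡ n (begin
        ι n * ι (sumℕ b)                       ≈⟨ ℂ.*-congˡ (ι-sum b) ⟩
        ι n * ∑ (ι ∘ b)                        ≈⟨ *-distribˡ-sum (ι n) (ι ∘ b) ⟩
        ∑ (λ t → ι n * ι (b t))                ≈⟨ sum-cong-≋ (λ t → proj₂ (multiplicity (g.to t))) ⟨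
        -- Both orders of summation add up all entries of the character matrix.
        ∑ (λ t → columnSum (g.to t))           ≈⟨ ∑-comm (λ t i → eval (χ.to i) (g.to t)) ⟩
        ∑ (λ i → rowSum (χ.to i))              ≈⟨ ∑-single (λ i → rowSum (χ.to i)) i₀ rowSum≈0 ⟩
        rowSum (χ.to i₀)                       ≈⟨ ∑-ones (λ t → χ.strictlyInverseˡ Ĝ.ε (g.to t)) ⟩
        ι n                                    ≈⟨ ℂ.*-identityʳ (ι n) ⟨
        ι n * 1#                               ≈⟨ ℂ.*-congˡ fromℚ-1 ⟨
        ι n * ι 1                              ∎))
      same-index : g.from x ≡ g.from G.ε
      same-index = sumℕ≡1⇒unique b Σb≡1 (b≡1 x x-trivial) (b≡1 G.ε eval-ε)

    inverseMatrix : Matrix n n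
    inverseMatrix j i = reciprocal n * eval (χ.to i) (g.to j G.⁻¹)

    -- The entries of the products are means: of the row of χᵢ χₗ⁻¹ in one order, of the column at
    -- gⱼ⁻¹ gₗ in the other. Off the diagonal the trivial case is excluded, because the enumerations
    -- are injective and characters separate elements.
    inverseMatrix-isInverse : IsInverse (characterMatrix G g χ.to) inverseMatrix
    inverseMatrix-isInverse = A*A⁻¹ , A⁻¹*A
      where
      mean≈1 : ∀ {f : Vector ℂ n} → (∀ i → f i ≈ 1#) → reciprocal n * ∑ f ≈ 1#
      mean≈1 f≈1 = ℂ.trans (ℂ.*-congˡ (∑-ones f≈1)) (ℂ.trans (ℂ.*-comm _ _) (ι*reciprocal n))
      mean≈0 : ∀ {x} → x ≈ 0# → reciprocal n * x ≈ 0#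
      mean≈0 x≈0 = ℂ.trans (ℂ.*-congˡ x≈0) (ℂ.zeroʳ _)
      A*A⁻¹ : ∀ i l → (characterMatrix G g χ.to *ₘ inverseMatrix) i l ≈ 𝟙 i l
      A*A⁻¹ i l = ℂ.trans (ℂ.trans
        (sum-cong-≋ (λ t → x∙yz≈y∙xz (eval (χ.to i) (g.to t)) (reciprocal n) (eval (χ.to l) (g.to t G.⁻¹))))
        (ℂ.sym (*-distribˡ-sum (reciprocal n) (λ t → eval (χ.to i Ĝ.∙ χ.to l Ĝ.⁻¹) (g.to t))))) entry
        where
        entry : reciprocal n * rowSum (χ.to i Ĝ.∙ χ.to l Ĝ.⁻¹) ≈ 𝟙 i l
        entry with i Fin.≟ l
        ... | yes ≡.refl = mean≈1 (λ t → eval-inverse (χ.to i) (g.to t))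
        ... | no  i≢l    = mean≈0 (Sum.fromInj₁
          (λ trivial → contradiction (χ-injective (quotient≈1⇒≈ {χ.to i} {χ.to l} trivial)) i≢l)
          (rowSum≈0∨trivial (χ.to i Ĝ.∙ χ.to l Ĝ.⁻¹)))
      A⁻¹*A : ∀ j l → (inverseMatrix *ₘ characterMatrix G g χ.to) j l ≈ 𝟙 j l
      A⁻¹*A j l = ℂ.trans (ℂ.trans
        (sum-cong-≋ (λ i → ℂ.trans (ℂ.*-assoc (reciprocal n) _ _) (ℂ.*-congˡ (ℂ.sym (eval-∙ (χ.to i) (g.to j G.⁻¹) (g.to l))))))
        (ℂ.sym (*-distribˡ-sum (reciprocal n) (λ i → eval (χ.to i) (g.to j G.⁻¹ G.∙ g.to l))))) entry
        where
        entry : reciprocal n * columnSum (g.to j G.⁻¹ G.∙ g.to l) ≈ 𝟙 j l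
        entry with j Fin.≟ l
        ... | yes ≡.refl = mean≈1 (λ i → ℂ.trans (eval-cong (χ.to i) (G.inverseˡ (g.to j))) (eval-ε (χ.to i)))
        ... | no  j≢l    = mean≈0 (Sum.fromInj₁
          (λ trivial → contradiction (g-injective (G.sym (x∙y⁻¹≈ε⇒x≈y (g.to l) (g.to j)
            (G.trans (G.comm _ _) (trivial⇒≈ε _ trivial))))) j≢l)
          (columnSum≈0∨trivial (g.to j G.⁻¹ G.∙ g.to l)))

-- The evaluation map of the group ring

sumℤ : Vector ℤ n → ℤ
sumℤ = RawMonoidOperations.sum (RawRing.+-rawMonoid +-*-rawRing)

fromℤ-sum : (f : Vector ℤ n) → fromℤ (sumℤ f) ≈ ∑ (fromℤ ∘ f)
fromℤ-sum {zero}  f = fromℚ-0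
fromℤ-sum {suc n} f = ℂ.trans (fromℤ-+ (f zero) (sumℤ (f ∘ suc))) (ℂ.+-congˡ (fromℤ-sum (f ∘ suc)))

𝟙-*ᵥ : (v : Vector ℂ n) → ∀ i → (𝟙 *ᵥ v) i ≈ v i
𝟙-*ᵥ v i = ℂ.trans (∑-single (λ j → 𝟙 i j * v j) i off-diagonal) diagonal
  where
  off-diagonal : ∀ j → j ≢ i → 𝟙 i j * v j ≈ 0#
  off-diagonal j j≢i with i Fin.≟ j
  ... | yes i≡j = contradiction (≡.sym i≡j) j≢i
  ... | no  _   = ℂ.zeroˡ (v j)
  diagonal : 𝟙 i i * v i ≈ v i
  diagonal with i Fin.≟ i
  ... | yes _   = ℂ.*-identityˡ (v i)
  ... | no  i≢i = contradiction ≡.refl i≢i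

*ᵥ-cong : ∀ {m n} (M : Matrix m n) {v w : Vector ℂ n} → (∀ j → v j ≈ w j) → ∀ i → (M *ᵥ v) i ≈ (M *ᵥ w) i
*ᵥ-cong {n = n} M v≈w i = sum-cong-≋ {n} (λ j → ℂ.*-congˡ (v≈w j))

*ᵥ-assoc : ∀ {l m n} (M : Matrix l m) (N : Matrix m n) (v : Vector ℂ n) → ∀ i → (M *ᵥ N *ᵥ v) i ≈ ((M *ₘ N) *ᵥ v) i
*ᵥ-assoc {l} {m} {n} M N v i = begin
  ∑ (λ s → M i s * ∑ (λ t → N s t * v t))
    ≈⟨ sum-cong-≋ {m} (λ s → *-distribˡ-sum {n} (M i s) (λ t → N s t * v t)) ⟩
  ∑ (λ s → ∑ (λ t → M i s * (N s t * v t)))    ≈⟨ ∑-comm {m} {n} (λ s t → M i s * (N s t * v t)) ⟩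
  ∑ (λ t → ∑ (λ s → M i s * (N s t * v t)))
    ≈⟨ sum-cong-≋ {n} (λ t → sum-cong-≋ {m} (λ s → ℂ.*-assoc (M i s) (N s t) (v t))) ⟨
  ∑ (λ t → ∑ (λ s → (M i s * N s t) * v t))
    ≈⟨ sum-cong-≋ {n} (λ t → *-distribʳ-sum {m} (v t) (λ s → M i s * N s t)) ⟨
  ∑ (λ t → (M *ₘ N) i t * v t)                 ∎

++-pointwise : ∀ {k r} {v : Vector ℂ k} {w : Vector ℂ r} (f : Vector ℂ (k +ℕ r)) →
               (∀ i → v i ≈ f (i ↑ˡ r)) → (∀ i → w i ≈ f (k ↑ʳ i)) → ∀ i → (v ++ w) i ≈ f i
++-pointwise {k} {r} {v} {w} f v≈ w≈ i =
  subst (λ j → (v ++ w) i ≈ f j) (Fin.join-splitAt k r i) (pointwise (Fin.splitAt k i))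
  where
  pointwise : ∀ s → Sum.[ v , w ]′ s ≈ f (Fin.join k r s)
  pointwise (inj₁ j) = v≈ j
  pointwise (inj₂ j) = w≈ j

-- Subrings of ℂ and automorphisms of subfields

module _ (S : Subring) where
  open Subring S

  ∑-closed : {f : Vector ℂ n} → (∀ i → Member (f i)) → Member (∑ f)
  ∑-closed {zero}  f∈ = 0-closed
  ∑-closed {suc n} f∈ = +-closed (f∈ zero) (∑-closed (f∈ ∘ suc))

  ι-closed : ∀ m → Member (ι m)
  ι-closed zero    = Subring.resp S (ℂ.sym fromℚ-0) 0-closed
  ι-closed (suc m) = Subring.resp S (ℂ.sym (ι-suc m)) (+-closed 1-closed (ι-closed m))

  fromℤ-closed : ∀ z → Member (fromℤ z)
  fromℤ-closed (ℤ.+ m)    = ι-closed m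
  fromℤ-closed ℤ.-[1+ m ] = Subring.resp S (ℂ.sym (fromℤ-neg (ℤ.+ suc m))) (neg-closed (ι-closed (suc m)))

-- Numerator and denominator lie in every subring, and `inv` supplies the inverse of the
-- denominator.
fromℚ∈ℚ⟨ζ⟩ : ∀ {ζ} r → fromℚ r ∈ℚ⟨ ζ ⟩
fromℚ∈ℚ⟨ζ⟩ {ζ} r = resp (begin
    fromℤ (ℚ.↥ r) * d⁻¹
      ≈⟨ ℂ.*-congʳ (ℂ.trans (ℂ.sym (fromℚ-* r _)) (ℂ.reflexive (cong fromℚ (ℤ⊂ℚ.*-denominator r)))) ⟨
    (fromℚ r * d) * d⁻¹           ≈⟨ ℂ.*-assoc _ _ _ ⟩
    fromℚ r * (d * d⁻¹)           ≈⟨ ℂ.*-congˡ (ι*reciprocal (ℚ.↧ₙ r)) ⟩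
    fromℚ r * 1#                  ≈⟨ ℂ.*-identityʳ _ ⟩
    fromℚ r                       ∎)
  (mul (fromℤ-closed ℚ[ζ] (ℚ.↥ r)) (inv (fromℤ-closed ℚ[ζ] (ℚ.↧ r)) (ι*reciprocal (ℚ.↧ₙ r))))
  where
  ℚ[ζ] = Subfield.subring ℚ⟨ ζ ⟩
  d = fromℤ (ℚ.↧ r)
  d⁻¹ = reciprocal (ℚ.↧ₙ r)

module AutomorphismProperties {K : Subfield} (σ : Automorphism K) where
  open Subfield K
  open Automorphism σ
  open IsRingIsomorphism isRingIsomorphism

  infix 4 _↦_
  -- The graph of σ as a relation on ℂ: it packs the membership proof away, so that images can be
  -- computed term by term in sums and products.
  record _↦_ (x y : ℂ) : Set where
    constructor maps
    field
      source : Member x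
      image  : proj₁ (map (x , source)) ≈ y

  open _↦_

  -- Equality in `K` compares the underlying numbers only, so σ gives equal images under different
  -- membership proofs.
  ↦-functional : ∀ {x x′ y y′} → x ↦ y → x′ ↦ y′ → x ≈ x′ → y ≈ y′
  ↦-functional (maps x∈ p) (maps x′∈ p′) x≈x′ =
    ℂ.trans (ℂ.sym p) (ℂ.trans (⟦⟧-cong {_ , x∈} {_ , x′∈} x≈x′) p′)

  ↦-injective : ∀ {x x′ y y′} → x ↦ y → x′ ↦ y′ → y ≈ y′ → x ≈ x′
  ↦-injective (maps x∈ p) (maps x′∈ p′) y≈y′ =
    injective {_ , x∈} {_ , x′∈} (ℂ.trans p (ℂ.trans y≈y′ (ℂ.sym p′)))

  ↦-+ : ∀ {x x′ y y′} → x ↦ y → x′ ↦ y′ → x + x′ ↦ y + y′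
  ↦-+ (maps x∈ p) (maps x′∈ p′) = maps (+-closed x∈ x′∈) (ℂ.trans (+-homo (_ , x∈) (_ , x′∈)) (ℂ.+-cong p p′))

  ↦-* : ∀ {x x′ y y′} → x ↦ y → x′ ↦ y′ → x * x′ ↦ y * y′
  ↦-* (maps x∈ p) (maps x′∈ p′) = maps (*-closed x∈ x′∈) (ℂ.trans (*-homo (_ , x∈) (_ , x′∈)) (ℂ.*-cong p p′))

  ↦-0 : 0# ↦ 0#
  ↦-0 = maps 0-closed 0#-homo

  ↦-∑ : {f f′ : Vector ℂ n} → (∀ i → f i ↦ f′ i) → ∑ f ↦ ∑ f′
  ↦-∑ {zero}  f↦f′ = ↦-0
  ↦-∑ {suc n} f↦f′ = ↦-+ (f↦f′ zero) (↦-∑ (f↦f′ ∘ suc))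

  -- Through `fromℤ-closed`, its being a subring shows that σ fixes the integers.
  fixedSubring : Subring
  fixedSubring = record
    { Member     = λ x → x ↦ x
    ; resp       = λ { x≈y (maps x∈ p) → maps (Subfield.resp K x≈y x∈)
                       (ℂ.trans (⟦⟧-cong {_ , Subfield.resp K x≈y x∈} {_ , x∈} (ℂ.sym x≈y)) (ℂ.trans p x≈y)) }
    ; 0-closed   = ↦-0
    ; 1-closed   = maps 1-closed 1#-homo
    ; +-closed   = ↦-+
    ; *-closed   = ↦-*
    ; neg-closed = λ { (maps x∈ p) → maps (neg-closed x∈) (ℂ.trans (-‿homo (_ , x∈)) (ℂ.-‿cong p)) }
    }

-- Linear extension of characters to ℤG

module Evaluation (G : AbelianGroup a ℓ) {n} (g : Inverse (setoid (Fin n)) (AbelianGroup.setoid G)) where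
  private
    module G = AbelianGroup G
    module g = Inverse g
  open CharacterProperties G

  evalℤ : Character G → Vector ℤ n → ℂ
  evalℤ χ h = evalℚ G g χ (ℤ⊂ℚ ∘ h)

  private
    ℤG = groupRing G g +-*-rawRing
    module ℤG = RawRing ℤG

  evalℤ-cong : ∀ χ {h h′} → h ℤG.≈ h′ → evalℤ χ h ≈ evalℤ χ h′
  evalℤ-cong χ h≈h′ = sum-cong-≋ {n} (λ j → ℂ.*-congʳ (ℂ.reflexive (cong fromℤ (h≈h′ j))))

  evalℤ-+ : ∀ χ h h′ → evalℤ χ (h ℤG.+ h′) ≈ evalℤ χ h + evalℤ χ h′
  evalℤ-+ χ h h′ = ℂ.trans
    (sum-cong-≋ {n} (λ j → ℂ.trans (ℂ.*-congʳ (fromℤ-+ (h j) (h′ j)))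
      (ℂ.distribʳ (eval χ (g.to j)) (fromℤ (h j)) (fromℤ (h′ j)))))
    (∑-distrib-+ {n} (λ j → fromℤ (h j) * eval χ (g.to j)) (λ j → fromℤ (h′ j) * eval χ (g.to j)))

  evalℤ-neg : ∀ χ h → evalℤ χ (ℤG.- h) ≈ - evalℤ χ h
  evalℤ-neg χ h = begin
    evalℤ χ (ℤG.- h)
      ≈⟨ sum-cong-≋ {n} (λ j → ℂ.trans (ℂ.*-congʳ (fromℤ-neg (h j))) (ℂ.trans (ℂ.sym (-‿distribˡ-* _ _)) (ℂ.sym (-1*x≈-x _)))) ⟩
    ∑ (λ j → - 1# * (fromℤ (h j) * eval χ (g.to j)))
      ≈⟨ *-distribˡ-sum {n} (- 1#) (λ j → fromℤ (h j) * eval χ (g.to j)) ⟨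
    - 1# * evalℤ χ h                                         ≈⟨ -1*x≈-x _ ⟩
    - evalℤ χ h                                              ∎

  evalℤ-0 : ∀ χ → evalℤ χ ℤG.0# ≈ 0#
  evalℤ-0 χ = ∑-zero {n} (λ j → ℂ.trans (ℂ.*-congʳ fromℚ-0) (ℂ.zeroˡ _))

  -- The vector is the element z x of ℤG, in the form from which `groupRing` builds its unit and its
  -- product.
  evalℤ-monomial : ∀ χ x z → evalℤ χ (λ t → if does (g.from x Fin.≟ t) then z else ℤ.0ℤ) ≈ fromℤ z * eval χ x
  evalℤ-monomial χ x z = begin
    evalℤ χ (λ t → if does (g.from x Fin.≟ t) then z else ℤ.0ℤ)
      ≈⟨ ∑-single {n} (λ t → coefficient t * eval χ (g.to t)) (g.from x) off ⟩
    coefficient (g.from x) * eval χ (g.to (g.from x))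
      ≈⟨ ℂ.*-cong on (eval-cong χ (g.strictlyInverseˡ x)) ⟩
    fromℤ z * eval χ x                                            ∎
    where
    coefficient : Fin n → ℂ
    coefficient t = fromℤ (if does (g.from x Fin.≟ t) then z else ℤ.0ℤ)
    off : ∀ t → t ≢ g.from x → coefficient t * eval χ (g.to t) ≈ 0#
    off t t≢ with g.from x Fin.≟ t
    ... | yes ≡t = contradiction (≡.sym ≡t) t≢
    ... | no  _  = ℂ.trans (ℂ.*-congʳ fromℚ-0) (ℂ.zeroˡ _)
    on : coefficient (g.from x) ≈ fromℤ z
    on with g.from x Fin.≟ g.from x
    ... | yes _ = ℂ.refl
    ... | no  ≢ = contradiction ≡.refl ≢

  evalℤ-1 : ∀ χ → evalℤ χ ℤG.1# ≈ 1#
  evalℤ-1 χ = ℂ.trans (evalℤ-monomial χ G.ε ℤ.1ℤ) (ℂ.trans (ℂ.*-cong fromℚ-1 (eval-ε χ)) (ℂ.*-identityˡ 1#))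

  evalℤ-sum : ∀ {m} χ (h : Fin m → Vector ℤ n) → evalℤ χ (λ t → sumℤ (λ i → h i t)) ≈ ∑ (λ i → evalℤ χ (h i))
  evalℤ-sum {m} χ h = begin
    ∑ (λ t → fromℤ (sumℤ (λ i → h i t)) * eval χ (g.to t))
      ≈⟨ sum-cong-≋ {n} (λ t → ℂ.trans (ℂ.*-congʳ (fromℤ-sum (λ i → h i t)))
           (*-distribʳ-sum {m} (eval χ (g.to t)) (λ i → fromℤ (h i t)))) ⟩
    ∑ (λ t → ∑ (λ i → fromℤ (h i t) * eval χ (g.to t)))
      ≈⟨ ∑-comm {n} {m} (λ t i → fromℤ (h i t) * eval χ (g.to t)) ⟩
    ∑ (λ i → evalℤ χ (h i))                                   ∎

  -- The product is a double sum of monomials; on each of them `χ` is multiplicative, and the double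
  -- sum of the values factors.
  evalℤ-* : ∀ χ h h′ → evalℤ χ (h ℤG.* h′) ≈ evalℤ χ h * evalℤ χ h′
  evalℤ-* χ h h′ = begin
    evalℤ χ (h ℤG.* h′)
      ≈⟨ evalℤ-sum {n} χ (λ i t → sumℤ (λ j → monomial i j t)) ⟩
    ∑ (λ i → evalℤ χ (λ t → sumℤ (λ j → monomial i j t)))
      ≈⟨ sum-cong-≋ {n} (λ i → evalℤ-sum {n} χ (monomial i)) ⟩
    ∑ (λ i → ∑ (λ j → evalℤ χ (monomial i j)))
      ≈⟨ sum-cong-≋ {n} (λ i → sum-cong-≋ {n} (λ j → ℂ.trans (evalℤ-monomial χ (g.to i G.∙ g.to j) (h i ℤ.* h′ j))
           (ℂ.trans (ℂ.*-cong (fromℤ-* (h i) (h′ j)) (eval-∙ χ (g.to i) (g.to j))) (interchange _ _ _ _)))) ⟩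
    ∑ (λ i → ∑ (λ j → (fromℤ (h i) * eval χ (g.to i)) * (fromℤ (h′ j) * eval χ (g.to j))))
      ≈⟨ sum-cong-≋ {n} (λ i → *-distribˡ-sum {n} (fromℤ (h i) * eval χ (g.to i)) (λ j → fromℤ (h′ j) * eval χ (g.to j))) ⟨
    ∑ (λ i → (fromℤ (h i) * eval χ (g.to i)) * evalℤ χ h′)
      ≈⟨ *-distribʳ-sum {n} (evalℤ χ h′) (λ i → fromℤ (h i) * eval χ (g.to i)) ⟨
    evalℤ χ h * evalℤ χ h′ ∎
    where
    monomial : Fin n → Fin n → Vector ℤ n
    monomial i j t = if does (g.from (g.to i G.∙ g.to j) Fin.≟ t) then h i ℤ.* h′ j else ℤ.0ℤ

  evalℤ-row : ∀ (χ : Fin n → Character G) h i → evalℤ (χ i) h ≈ (characterMatrix G g χ *ᵥ (fromℤ ∘ h)) i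
  evalℤ-row χ h i = sum-cong-≋ {n} (λ j → ℂ.*-comm (fromℤ (h j)) (eval (χ i) (g.to j)))

  -- σ fixes the integer coefficients and sends each χ(gⱼ) to χ′(gⱼ).
  evalℤ-↦ : ∀ {K} (σ : Automorphism K) χ χ′ → IsImage G K σ χ χ′ →
            ∀ h → AutomorphismProperties._↦_ σ (evalℤ χ h) (evalℤ χ′ h)
  evalℤ-↦ σ χ χ′ σχ≈χ′ h = ↦-∑ {n} (λ j → ↦-* (fromℤ-closed fixedSubring (h j)) (let x∈ , p = σχ≈χ′ (g.to j) in maps x∈ p))
    where open AutomorphismProperties σ

  AgreeOn : Vector ℤ n → Vector ℤ n → Character G → Set
  AgreeOn h h′ χ = evalℤ χ h ≈ evalℤ χ h′

  conjugate-agree : ∀ h h′ χ χ′ → Conjugate G χ χ′ → AgreeOn h h′ χ → AgreeOn h h′ χ′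
  conjugate-agree h h′ χ χ′ (_ , _ , _ , σ , σχ≈χ′) =
    AutomorphismProperties.↦-functional σ (evalℤ-↦ σ χ χ′ σχ≈χ′ h) (evalℤ-↦ σ χ χ′ σχ≈χ′ h′)

  -- Injectivity of σ replaces passing to the inverse automorphism.
  conjugate-agree⁻¹ : ∀ h h′ χ χ′ → Conjugate G χ χ′ → AgreeOn h h′ χ′ → AgreeOn h h′ χ
  conjugate-agree⁻¹ h h′ χ χ′ (_ , _ , _ , σ , σχ≈χ′) =
    AutomorphismProperties.↦-injective σ (evalℤ-↦ σ χ χ′ σχ≈χ′ h) (evalℤ-↦ σ χ χ′ σχ≈χ′ h′)

  -- Maximality does not produce a conjugate of χᵢ in S, but it rules out that there is none.
  agree-everywhere : ∀ {m} {χ : Fin m → Character G} {S : Fin m → Set} → IsMaximalNonConjugate G χ S →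
                     ∀ h h′ → (∀ {i} → S i → AgreeOn h h′ (χ i)) → ∀ i → ¬ ¬ AgreeOn h h′ (χ i)
  agree-everywhere {χ = χ} {S} (nonConjugate , maximal) h h′ agree i ¬agree =
    -- Values at conjugate characters agree together, so if they disagree at χᵢ, then χᵢ is
    -- conjugate to no member of `S`. Maximality, applied to `S` with i adjoined, then puts i into
    -- `S`, where they agree.
    ¬agree (agree (maximal (λ j → S j ⊎ j ≡ i) extended inj₁ (inj₂ ≡.refl)))
    where
    extended : PairwiseNonConjugate G χ (λ j → S j ⊎ j ≡ i)
    extended (inj₁ j∈S)    (inj₁ l∈S)    j≢l      = nonConjugate j∈S l∈S j≢l
    extended {j} (inj₁ j∈S) (inj₂ ≡.refl) j≢l conj = ¬agree (conjugate-agree h h′ (χ j) (χ i) conj (agree j∈S))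
    extended {_} {l} (inj₂ ≡.refl) (inj₁ l∈S) j≢l conj = ¬agree (conjugate-agree⁻¹ h h′ (χ i) (χ l) conj (agree l∈S))
    extended (inj₂ ≡.refl) (inj₂ ≡.refl) j≢l      = contradiction ≡.refl j≢l

  module _ (χ : Inverse (setoid (Fin n)) (characterSetoid G)) where
    open Orthogonality g χ

    -- A maps the coefficients of `h` to the values χᵢ(h), and A⁻¹ undoes this. It serves both the
    -- injectivity and the inversion formula.
    coefficients : ∀ h {c} → (∀ i → c i ≈ evalℤ (to χ i) h) → ∀ j → fromℤ (h j) ≈ (inverseMatrix *ᵥ c) j
    coefficients h {c} c≈ j = begin
      fromℤ (h j)                                         ≈⟨ 𝟙-*ᵥ (fromℤ ∘ h) j ⟨
      (𝟙 *ᵥ (fromℤ ∘ h)) j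
        ≈⟨ sum-cong-≋ {n} (λ l → ℂ.*-congʳ (proj₂ inverseMatrix-isInverse j l)) ⟨
      ((inverseMatrix *ₘ A) *ᵥ (fromℤ ∘ h)) j             ≈⟨ *ᵥ-assoc inverseMatrix A (fromℤ ∘ h) j ⟨
      (inverseMatrix *ᵥ A *ᵥ (fromℤ ∘ h)) j
        ≈⟨ *ᵥ-cong inverseMatrix (λ i → ℂ.trans (c≈ i) (evalℤ-row (to χ) h i)) j ⟨
      (inverseMatrix *ᵥ c) j                              ∎
      where A = characterMatrix G g (to χ)

    -- Equality of integers is decidable, hence stable, so agreement up to double negation is
    -- enough; finiteness of the index set moves the double negation outside the quantifier.
    evalℤ-injective : ∀ {h h′} → (∀ i → ¬ ¬ AgreeOn h h′ (to χ i)) → h ℤG.≈ h′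
    evalℤ-injective {h} {h′} agree j = decidable-stable (h j ℤ.≟ h′ j)
      (¬¬-map (λ agree → fromℤ-injective (ℂ.trans
          (coefficients h (λ i → ℂ.sym (agree i)) j) (ℂ.sym (coefficients h′ (λ _ → ℂ.refl) j))))
        (Fin.sequence (RawMonad.rawApplicative ¬¬-Monad) agree))

proposition3p4 : ∀ {a ℓ} (G : AbelianGroup a ℓ) (k r : ℕ)
    (g : Inverse (setoid (Fin (k +ℕ r))) (AbelianGroup.setoid G))
    (χ : Inverse (setoid (Fin (k +ℕ r))) (characterSetoid G)) →
    IsMaximalNonConjugate G (to χ) (λ i → toℕ i < k) →
    (q : Fin (k +ℕ r) → ℕ) →
    (∀ i → HasOrder (RawGroup.rawMonoid (characterGroup G)) (to χ i) (q i)) →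
    (ζ : ℕ → ℂ) → (∀ m → 0 < m → IsPrimitiveRoot m (ζ m)) →
    Σ[ φ ∈ (Vector ℚ (k +ℕ r) → (i : Fin k) → Subfield.Carrier ℚ⟨ ζ (q (i ↑ˡ r)) ⟩) ]
    (∀ h i → proj₁ (φ h i) ≈ evalℚ G g (to χ (i ↑ˡ r)) h) ×
    Σ[ ψ ∈ (Vector ℤ (k +ℕ r) → (i : Fin k) → Subring.Carrier ℤ[ ζ (q (i ↑ˡ r)) ]) ]
    (∀ h i → proj₁ (ψ h i) ≈ proj₁ (φ (ℤ⊂ℚ ∘ h) i)) ×
    IsRingMonomorphism (groupRing G g +-*-rawRing) (⨁ (λ i → Subring.rawRing ℤ[ ζ (q (i ↑ˡ r)) ])) ψ ×
    (∀ h i → proj₁ (ψ h i) ≈ (take k (characterMatrix G g (to χ)) *ᵥ (fromℤ ∘ h)) i) ×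
    Σ[ A⁻¹ ∈ Matrix (k +ℕ r) (k +ℕ r) ]
    IsInverse (characterMatrix G g (to χ)) A⁻¹ ×
    ((κ : Fin r → Fin k) (σ : ∀ i → Automorphism ℚ⟨ ζ (q (κ i ↑ˡ r)) ⟩) →
    (∀ i → Conjugate G (to χ (κ i ↑ˡ r)) (to χ (k ↑ʳ i))) →
    (∀ i → IsImage G ℚ⟨ ζ (q (κ i ↑ˡ r)) ⟩ (σ i) (to χ (κ i ↑ˡ r)) (to χ (k ↑ʳ i))) →
    ∀ (h : Vector ℤ (k +ℕ r)) (c : (i : Fin k) → Subring.Carrier ℤ[ ζ (q (i ↑ˡ r)) ]) →
    (∀ i → proj₁ (ψ h i) ≈ proj₁ (c i)) →
    ∀ j → fromℤ (h j) ≈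
    (A⁻¹ *ᵥ ((λ i → proj₁ (c i)) ++ (λ i → proj₁ (Automorphism.map (σ i) (ℤ[ζ]⊂ℚ⟨ζ⟩ (c (κ i))))))) j)
proposition3p4 G k r g χ maximal q orders ζ ζ-primitive =
  φ , (λ _ _ → ℂ.refl) , ψ , (λ _ _ → ℂ.refl) , ψ-isRingMonomorphism ,
  (λ h i → evalℤ-row (to χ) h (i ↑ˡ r)) , inverseMatrix , inverseMatrix-isInverse ,
  -- The extended vector consists of all values χᵢ(h): the first block by hypothesis, the second
  -- because σᵢ sends the value of the representative, which is `c (κ i)`, to that of its conjugate.
  (λ κ σ _ images h c ψh≈c → coefficients χ h (++-pointwise (λ i → evalℤ (to χ i) h) (λ i → ℂ.sym (ψh≈c i))
    (λ i → let open AutomorphismProperties (σ i) in ↦-functional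
      (maps (proj₂ (ℤ[ζ]⊂ℚ⟨ζ⟩ (c (κ i)))) ℂ.refl)
      (evalℤ-↦ (σ i) (to χ (κ i ↑ˡ r)) (to χ (k ↑ʳ i)) (images i) h)
      (ℂ.sym (ψh≈c (κ i))))))
  where
  open CharacterProperties G
  open Orthogonality g χ
  open Evaluation G g

  -- The values of χᵢ are roots of unity of exponent `q i`, hence powers of `ζ (q i)`.
  eval∈ℤ[ζ] : ∀ i x → eval (to χ i) x ∈ℤ[ ζ (q i) ]
  eval∈ℤ[ζ] i x = root∈ℤ[ζ] (ζ-primitive (q i) (proj₁ (orders i))) (order⇒root (orders i) x)

  φ : Vector ℚ (k +ℕ r) → (i : Fin k) → Subfield.Carrier ℚ⟨ ζ (q (i ↑ˡ r)) ⟩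
  φ h i = evalℚ G g (to χ (i ↑ˡ r)) h ,
    ∑-closed (Subfield.subring ℚ⟨ _ ⟩) (λ j → mul (fromℚ∈ℚ⟨ζ⟩ (h j)) (proj₂ (ℤ[ζ]⊂ℚ⟨ζ⟩ (_ , eval∈ℤ[ζ] (i ↑ˡ r) (to g j)))))

  -- The numbers are those of `φ` by computation; the membership proofs now place them in ℤ[ζ].
  ψ : Vector ℤ (k +ℕ r) → (i : Fin k) → Subring.Carrier ℤ[ ζ (q (i ↑ˡ r)) ]
  ψ h i = evalℤ (to χ (i ↑ˡ r)) h ,
    ∑-closed ℤ[ _ ] (λ j → mul (fromℤ-closed ℤ[ _ ] (h j)) (eval∈ℤ[ζ] (i ↑ˡ r) (to g j)))

  ψ-injective : ∀ {h h′} → (∀ i → AgreeOn h h′ (to χ (i ↑ˡ r))) → ∀ j → h j ≡ h′ j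
  ψ-injective {h} {h′} ψh≈ψh′ = evalℤ-injective χ (agree-everywhere {χ = to χ} maximal h h′ λ {i} i<k →
    subst (λ i → AgreeOn h h′ (to χ i))
      -- An index below k is the inclusion of an index of `Fin k`, where the hypothesis applies.
      (Fin.toℕ-injective (≡.trans (Fin.toℕ-↑ˡ (Fin.fromℕ< i<k) r) (Fin.toℕ-fromℕ< i<k)))
      (ψh≈ψh′ (Fin.fromℕ< i<k)))

  ψ-isRingMonomorphism : IsRingMonomorphism (groupRing G g +-*-rawRing) (⨁ (λ i → Subring.rawRing ℤ[ ζ (q (i ↑ˡ r)) ])) ψ
  ψ-isRingMonomorphism = record
    { isRingHomomorphism = record
      { isSemiringHomomorphism = record
        { isNearSemiringHomomorphism = record
          { +-isMonoidHomomorphism = record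
            { isMagmaHomomorphism = record
              { isRelHomomorphism = record { cong = λ h≈h′ i → evalℤ-cong (to χ (i ↑ˡ r)) h≈h′ }
              ; homo = λ h h′ i → evalℤ-+ (to χ (i ↑ˡ r)) h h′
              }
            ; ε-homo = λ i → evalℤ-0 (to χ (i ↑ˡ r))
            }
          ; *-homo = λ h h′ i → evalℤ-* (to χ (i ↑ˡ r)) h h′
          }
        ; 1#-homo = λ i → evalℤ-1 (to χ (i ↑ˡ r))
        }
      ; -‿homo = λ h i → evalℤ-neg (to χ (i ↑ˡ r)) h
      }
    ; injective = ψ-injective
    }
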